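{- For every $\eta>0$ there is a constant $c_0$ such that for every integer constant $c\ge c_0$ there is a constant $C$ (depending only on $c$) for which the following holds for every $k\ge 2$. If $k$ stations execute the protocol NonAdaptiveWithK$(k,c)$ and are activated by any adaptive adversary, then with probability at least $1-1/k^{\eta}$ every station transmits successfully within $Ck$ rounds after its own activation.
   Context: Model. $k$ anonymous identical stations share a channel. Time is divided into discrete synchronous rounds; there is no global clock available to the stations and no collision detection. Initially all stations are asleep. Each station holds one packet and is activated once, at a time chosen by an adversary. The activation round is round $0$ of the station's local clock, and the station may transmit from its local round $1$ on. In each round every active station either transmits or listens. A transmission is successful if and only if exactly one active station transmits in that round; the transmitter then receives an acknowledgement. In all other cases (silence or collision, which are indistinguishable to listeners) nothing is received. The algorithm is non-adaptive: transmission decisions depend only on the local round number (and private randomness), and a station switches off permanently right after its first successful transmission. An adaptive adversary decides online which station to activate and when, knowing the algorithm's code and the history of the computation but not future randomness; in total it activates $k$ stations. Protocol NonAdaptiveWithK$(k,c)$ (executed by each station from its activation, $\log$ is base $2$): for $0\le l\le \log\log k$ let $\varphi(l)=k/2^l$ if $l<\log\log k$ and $\varphi(l)=k$ if $l=\log\log k$. For $l=0,1,2,\ldots,\log\log k$: for $c\varphi(l)$ rounds, transmit in each round with probability $\frac{2^l}{2k}$, independently over rounds and stations. A station that has finished all iterations transmits no more. Quantities such as $\log\log k$ and $k/2^l$ are treated as integers (rounding is ignored). -}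

module Defs where

open import Algebra.Definitions.RawSemiring using () renaming (_^_ to pow)
open import Data.Bool using (if_then_else_)
import Data.Bool.Properties as Bool
open import Data.Fin using (Fin; zero; suc)
open import Data.Fin.Properties using (all?)
open import Data.Fin.Subset using (Subset; inside; outside; ⁅_⁆; _∈_)
open import Data.Fin.Subset.Properties using (_∈?_)
open import Data.Integer using (+_)
open import Data.List using (List; []; _∷_; concatMap; drop; head; replicate; upTo)
open import Data.Maybe using (fromMaybe)
open import Data.Nat as ℕ using (ℕ; zero; suc; NonZero)
import Data.Nat.DivMod as ℕ
import Data.Nat.Properties as ℕ
open import Data.Nat.Logarithm using (⌈log₂_⌉)
open import Data.Product using (∃; ∃-syntax; _×_)
open import Data.Rational using (ℚ; 0ℚ; 1ℚ; _+_; _*_; _-_; _/_; _<_; _≤_; +-*-rawSemiring)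
open import Data.Sum using (_⊎_)
open import Data.Unit using (⊤; tt)
open import Data.Vec using ([]; _∷_)
import Data.Vec.Properties as Vec
open import Function using (_∘_; _⇔_)
open import Relation.Binary.PropositionalEquality using (_≡_; _≢_)
open import Relation.Nullary using (¬_; Dec; yes; does)
open import Level using (0ℓ)
open import Relation.Unary using (Pred; Decidable)

------------------------------------------------------------------------
-- Real numbers and the bound x ≤ 1 / kʳ

-- Two-sided Dedekind cuts: lower q means q < r and upper q means r < q.
record ℝ : Set₁ where
  field
    lower upper     : ℚ → Set
    lower-inhabited : ∃ lower
    upper-inhabited : ∃ upper
    lower-rounded   : ∀ q → lower q ⇔ (∃[ r ] q < r × lower r)
    upper-rounded   : ∀ q → upper q ⇔ (∃[ r ] r < q × upper r)
    disjoint        : ∀ q → ¬ (lower q × upper q)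
    located         : ∀ q r → q < r → lower q ⊎ upper r

open ℝ public

Positive : ℝ → Set
Positive r = lower r 0ℚ

infixr 8 _^ℚ_
_^ℚ_ : ℚ → ℕ → ℚ
_^ℚ_ = pow +-*-rawSemiring

-- x ≤ 1 / kʳ, for x ≥ 0, k ≥ 1 and r > 0.  Since kʳ is the supremum of k^(p/q)
-- over the rationals 0 ≤ p/q < r, this says x · k^(p/q) ≤ 1 for all such p/q,
-- and the q-th power of that inequality involves rational numbers only.
_≤1/_^_ : ℚ → ℕ → ℝ → Set
x ≤1/ k ^ r = ∀ p q .{{_ : NonZero q}} → lower r (+ p / q) →
              x ^ℚ q * (+ k / 1) ^ℚ p ≤ 1ℚ

------------------------------------------------------------------------
-- The protocol.  Rounding is fixed to be upwards throughout.

⌈_/2^_⌉ : ℕ → ℕ → ℕ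
⌈ k /2^ l ⌉ = ℕ._/_ (k ℕ.+ (2 ℕ.^ l ℕ.∸ 1)) (2 ℕ.^ l) {{ℕ.m^n≢0 2 l}}

-- ⌈log₂ ⌈log₂ k⌉⌉ equals ⌈log₂ (log₂ k)⌉ for every k ≥ 2.
loglog : ℕ → ℕ
loglog k = ⌈log₂ ⌈log₂ k ⌉ ⌉

φ : ℕ → ℕ → ℕ
φ k l = if l ℕ.<ᵇ loglog k then ⌈ k /2^ l ⌉ else k

phaseProb : (k : ℕ) .{{_ : NonZero k}} → ℕ → ℚ
phaseProb k l = _/_ (+ (2 ℕ.^ l)) (2 ℕ.* k) {{ℕ.m*n≢0 2 k}}

-- Entry number a (counting from 0) is the transmission probability in local
-- round a + 1; the local round 0 of the activation has no entry.
NonAdaptiveWithK : (k : ℕ) .{{_ : NonZero k}} → ℕ → List ℚ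
NonAdaptiveWithK k c =
  concatMap (λ l → replicate (c ℕ.* φ k l) (phaseProb k l)) (upTo (suc (loglog k)))

------------------------------------------------------------------------
-- The channel.  The labels in Fin k serve the adversary and the analysis only:
-- all stations follow the same list of probabilities.

record Round (k : ℕ) : Set where
  constructor round
  field
    activated    : Subset k
    transmitters : Subset k

open Round public

-- All past rounds, the latest one first.
History : ℕ → Set
History k = List (Round k)

data Status : Set where
  asleep    : Status
  active    : (a : ℕ) → Status  -- local rounds 0, …, a are over, without success
  delivered : (a : ℕ) → Status  -- first success in local round a

_≟ˢ_ : ∀ {k} (S T : Subset k) → Dec (S ≡ T)
_≟ˢ_ = Vec.≡-dec Bool._≟_

-- Activating a station that is no longer asleep has no effect.
advance : ∀ {k} → Round k → Fin k → Status → Status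
advance r i asleep        = if does (i ∈? activated r) then active 0 else asleep
advance r i (active a)    = if does (transmitters r ≟ˢ ⁅ i ⁆) then delivered (suc a) else active (suc a)
advance r i (delivered a) = delivered a

status : ∀ {k} → History k → Fin k → Status
status []      i = asleep
status (r ∷ h) i = advance r i (status h i)

-- Probability of transmitting in the next round, for a station running the
-- non-adaptive algorithm with the given probabilities.
txProb : List ℚ → Status → ℚ
txProb ps asleep        = 0ℚ
txProb ps (active a)    = fromMaybe 0ℚ (head (drop a ps))
txProb ps (delivered a) = 0ℚ

------------------------------------------------------------------------
-- The adversary

-- The stations to activate in the next round, as a function of the past.
Adversary : ℕ → Set
Adversary k = History k → Subset k

-- The first t rounds when S s is the set of transmitters of round s.
execution : ∀ {k} → Adversary k → (ℕ → Subset k) → ℕ → History k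
execution A S zero    = []
execution A S (suc t) = let h = execution A S t in round (A h) (S t) ∷ h

-- Every finite part of the execution has positive probability.  Listening needs
-- no condition if all entries of ps are below 1, as those of NonAdaptiveWithK
-- are for k ≥ 2.
Possible : ∀ {k} → List ℚ → Adversary k → (ℕ → Subset k) → Set
Possible ps A S = ∀ t i → i ∈ S t → 0ℚ < txProb ps (status (execution A S t) i)

ActivatesAll : ∀ {k} → List ℚ → Adversary k → Set
ActivatesAll ps A = ∀ S → Possible ps A S →
                    ∀ i → ∃[ t ] status (execution A S t) i ≢ asleep

------------------------------------------------------------------------
-- Probability

-- Expectation of f over the random subset that contains each i independently
-- with probability p i.
𝔼-subset : ∀ {n} → (Fin n → ℚ) → (Subset n → ℚ) → ℚ
𝔼-subset {zero}  p f = f []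
𝔼-subset {suc n} p f =
  p zero          * 𝔼-subset (p ∘ suc) (f ∘ (inside  ∷_)) +
  (1ℚ - p zero)   * 𝔼-subset (p ∘ suc) (f ∘ (outside ∷_))

-- Expectation of f of the history after T more rounds, given the history h.
𝔼-run : ∀ {k} → List ℚ → Adversary k → ℕ → (History k → ℚ) → History k → ℚ
𝔼-run ps A zero    f h = f h
𝔼-run ps A (suc T) f h =
  𝔼-subset (λ i → txProb ps (status h i)) (λ S → 𝔼-run ps A T f (round (A h) S ∷ h))

-- Probability that the history of the first T rounds satisfies P.
Pr : ∀ {k} {P : Pred (History k) 0ℓ} → List ℚ → Adversary k → ℕ → Decidable P → ℚ
Pr ps A T P? = 𝔼-run ps A T (λ h → if does (P? h) then 1ℚ else 0ℚ) []

------------------------------------------------------------------------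
-- Success within d rounds

-- The station has succeeded within d rounds of its activation, or still can.
OnTime : ℕ → Status → Set
OnTime d asleep        = ⊤
OnTime d (active a)    = a ℕ.< d
OnTime d (delivered a) = a ℕ.≤ d

onTime? : ∀ d → Decidable (OnTime d)
onTime? d asleep        = yes tt
onTime? d (active a)    = a ℕ.<? d
onTime? d (delivered a) = a ℕ.≤? d

AllOnTime : ∀ {k} → ℕ → History k → Set
AllOnTime d h = ∀ i → OnTime d (status h i)

allOnTime? : ∀ {k} d → Decidable (AllOnTime {k} d)
allOnTime? d h = all? (λ i → onTime? d (status h i))

-- “With probability at least 1 - 1/kʳ, every station transmits successfully
-- within d rounds after its own activation.”  If every station is eventually
-- activated, this event of infinite executions is the intersection over T of
-- the decreasing events “AllOnTime d after T rounds”, so that its probability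
-- is the infimum of theirs.
SucceedWithinWhp : ∀ {k} → ℕ → ℝ → List ℚ → Adversary k → Set
SucceedWithinWhp {k} d r ps A = ∀ T → (1ℚ - Pr ps A T (allOnTime? d)) ≤1/ k ^ r

{-# OPTIONS --safe #-}
module Submission where

-- Let every round multiply the growth factor of a station that is active with transmission
-- probability p by 1 + p/4.  As long as the transmission probabilities of the active stations
-- sum to at most 3/4, a transmitter is alone with probability at least 1/4.  Since at most
-- one station succeeds in a round, the product over all stations of 1 + ψ · growth (of 1 for
-- the stations that have succeeded) is then a supermartingale, for every ψ ≥ 0 and against
-- every adaptive adversary.
--
-- For large c every phase multiplies the growth by a large constant.  With ψ of order
-- 1 / log k a station in phase l > 0 therefore contributes at least R^(2·2^l) to the product,
-- where R is a large power of 1 + ψ, while stations in phase 0 have total transmission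
-- probability at most 1/2; so the sum can exceed 3/4 only if the product exceeds R^k, which
-- is unlikely.  The last phase alone lets the growth exceed a large power of k; with ψ = 1/2k
-- the initial product is at most 2, so it is unlikely that a station completes that phase
-- without success.

open import Defs
import Algebra.Definitions.RawMonoid as RawMonoid
import Algebra.Properties.CommutativeSemiring.Exp as CommutativeSemiringExp
import Algebra.Properties.Semiring.Exp as SemiringExp
open import Algebra.Bundles using (CommutativeRing)
open import Data.Bool using (T; true; false; if_then_else_)
open import Data.Fin using (Fin; zero; suc)
open import Data.Fin.Properties using (¬∀⟶∃¬)
open import Data.Fin.Subset using (Subset; ⁅_⁆; ⊥)
open import Data.Fin.Subset.Properties using (_∈?_)
open import Data.Integer as ℤ using (+_)
import Data.Integer.Properties as ℤ
open import Data.List using (List; []; _∷_; _++_; concatMap; length; replicate; upTo)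
open import Data.List.Properties using (length-++; length-replicate; upTo-∷ʳ; concatMap-++; ++-identityʳ)
open import Data.Nat as ℕ using (ℕ; zero; suc; NonZero; z≤n; s≤s; ⌊_/2⌋; ⌈_/2⌉)
import Data.Nat.DivMod as ℕ
open import Data.Nat.Induction using (<-wellFounded)
open import Data.Nat.Logarithm using (⌈log₂_⌉; ⌈log₂⌉-mono-≤)
open import Data.Nat.Logarithm.Core using (⌈log2⌉)
import Data.Nat.Properties as ℕ
open import Data.Nat.Tactic.RingSolver using () renaming (solve-∀ to solveℕ-∀)
open import Data.Product using (Σ; ∃; ∃-syntax; _×_; _,_; proj₁; proj₂)
open import Data.Rational as ℚ hiding (NonZero; Positive; round)
open import Data.Rational.Properties
import Data.Rational.Unnormalised as ℚᵘ
import Data.Rational.Unnormalised.Properties as ℚᵘ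
open import Data.Sum using (_⊎_; inj₁; inj₂; [_,_]′)
open import Data.Unit using (tt)
open import Data.Vec using ([]; _∷_)
open import Function using (_∘_; Equivalence)
open import Induction.WellFounded using (Acc; acc)
open import Level using (0ℓ)
open import Relation.Binary.PropositionalEquality
open import Relation.Nullary using (¬_; Dec; does; yes; no; contradiction)
open import Relation.Nullary.Decidable using (dec⇒maybe; from-yes)
open import Tactic.RingSolver using (solve-∀)
open import Tactic.RingSolver.Core.AlmostCommutativeRing using (AlmostCommutativeRing; fromCommutativeRing)

open CommutativeSemiringExp (CommutativeRing.commutativeSemiring +-*-commutativeRing) using (^-distrib-*)
open SemiringExp (CommutativeRing.semiring +-*-commutativeRing) using (^-homo-*; ^-assocʳ)
open RawMonoid *-1-rawMonoid using () renaming (sum to ∏)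
open RawMonoid +-0-rawMonoid using () renaming (sum to ∑)
open RawMonoid ℕ.+-0-rawMonoid using () renaming (sum to ∑ℕ)

-- Rational arithmetic

ring : AlmostCommutativeRing 0ℓ 0ℓ
ring = fromCommutativeRing +-*-commutativeRing λ x → dec⇒maybe (0ℚ ≟ x)

0≤1 : 0ℚ ≤ 1ℚ
0≤1 = from-yes (0ℚ ≤? 1ℚ)

-- The slack `r` is named explicitly: its sign follows from its shape, and the remaining equation is
-- left to the ring solver.
≤-by : ∀ {p q} r → 0ℚ ≤ r → q ≡ p + r → p ≤ q
≤-by {p} r 0≤r refl = subst (_≤ p + r) (+-identityʳ p) (+-monoʳ-≤ p 0≤r)

p≤q⇒0≤q-p : ∀ {p q} → p ≤ q → 0ℚ ≤ q - p
p≤q⇒0≤q-p {p} {q} p≤q = subst (_≤ q - p) (+-inverseʳ p) (+-monoˡ-≤ (- p) p≤q)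

+-nonNeg : ∀ {p q} → 0ℚ ≤ p → 0ℚ ≤ q → 0ℚ ≤ p + q
+-nonNeg = +-mono-≤

*-monoˡ-≤ : ∀ {p q} r → 0ℚ ≤ r → p ≤ q → r * p ≤ r * q
*-monoˡ-≤ r 0≤r = *-monoˡ-≤-nonNeg r {{nonNegative 0≤r}}

*-monoʳ-≤ : ∀ {p q} r → 0ℚ ≤ r → p ≤ q → p * r ≤ q * r
*-monoʳ-≤ r 0≤r = *-monoʳ-≤-nonNeg r {{nonNegative 0≤r}}

*-mono-≤ : ∀ {p q r s} → 0ℚ ≤ p → 0ℚ ≤ r → p ≤ q → r ≤ s → p * r ≤ q * s
*-mono-≤ 0≤p 0≤r p≤q r≤s =
  ≤-trans (*-monoʳ-≤ _ 0≤r p≤q) (*-monoˡ-≤ _ (≤-trans 0≤p p≤q) r≤s)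

*-nonNeg : ∀ {p q} → 0ℚ ≤ p → 0ℚ ≤ q → 0ℚ ≤ p * q
*-nonNeg {p} {q} 0≤p 0≤q = subst (_≤ p * q) (*-zeroʳ p) (*-monoˡ-≤ p 0≤p 0≤q)

1≤* : ∀ {p q} → 1ℚ ≤ p → 1ℚ ≤ q → 1ℚ ≤ p * q
1≤* = *-mono-≤ 0≤1 0≤1

^-nonNeg : ∀ {x} n → 0ℚ ≤ x → 0ℚ ≤ x ^ℚ n
^-nonNeg zero    0≤x = 0≤1
^-nonNeg (suc n) 0≤x = *-nonNeg 0≤x (^-nonNeg n 0≤x)

^-monoˡ-≤ : ∀ {x y} n → 0ℚ ≤ x → x ≤ y → x ^ℚ n ≤ y ^ℚ n
^-monoˡ-≤ zero    0≤x x≤y = ≤-refl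
^-monoˡ-≤ (suc n) 0≤x x≤y = *-mono-≤ 0≤x (^-nonNeg n 0≤x) x≤y (^-monoˡ-≤ n 0≤x x≤y)

1≤^ : ∀ {x} n → 1ℚ ≤ x → 1ℚ ≤ x ^ℚ n
1≤^ zero    1≤x = ≤-refl
1≤^ (suc n) 1≤x = 1≤* 1≤x (1≤^ n 1≤x)

^≤1 : ∀ {x} n → 0ℚ ≤ x → x ≤ 1ℚ → x ^ℚ n ≤ 1ℚ
^≤1 zero    0≤x x≤1 = ≤-refl
^≤1 (suc n) 0≤x x≤1 = *-mono-≤ 0≤x (^-nonNeg n 0≤x) x≤1 (^≤1 n 0≤x x≤1)

^-monoʳ-≤ : ∀ {x m n} → 1ℚ ≤ x → m ℕ.≤ n → x ^ℚ m ≤ x ^ℚ n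
^-monoʳ-≤ {n = n} 1≤x z≤n  = 1≤^ n 1≤x
^-monoʳ-≤ 1≤x (s≤s m≤n) = *-monoˡ-≤ _ (≤-trans 0≤1 1≤x) (^-monoʳ-≤ 1≤x m≤n)

1^n≡1 : ∀ n → 1ℚ ^ℚ n ≡ 1ℚ
1^n≡1 zero    = refl
1^n≡1 (suc n) = trans (*-identityˡ _) (1^n≡1 n)

-- Natural numbers as rationals

⟦_⟧ : ℕ → ℚ
⟦ n ⟧ = + n / 1

-- Normalised fractions with variable entries do not compute; identities between them are checked
-- among unnormalised fractions, where equality is cross-multiplication.
toℚᵘ-/ : ∀ i n .{{_ : NonZero n}} → toℚᵘ (i / n) ℚᵘ.≃ (i ℚᵘ./ n)
toℚᵘ-/ i (suc n) = toℚᵘ-fromℚᵘ (ℚᵘ.mkℚᵘ i n)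

⟦⟧-+ : ∀ m n → ⟦ m ℕ.+ n ⟧ ≡ ⟦ m ⟧ + ⟦ n ⟧
⟦⟧-+ m n = toℚᵘ-injective (begin
  toℚᵘ ⟦ m ℕ.+ n ⟧              ≈⟨ toℚᵘ-/ (+ (m ℕ.+ n)) 1 ⟩
  + (m ℕ.+ n) ℚᵘ./ 1            ≈⟨ ℚᵘ.*≡* (cong (ℤ._* + 1) (cong₂ ℤ._+_ (sym (ℤ.*-identityʳ (+ m))) (sym (ℤ.*-identityʳ (+ n))))) ⟩
  + m ℚᵘ./ 1 ℚᵘ.+ + n ℚᵘ./ 1    ≈⟨ ℚᵘ.+-cong (toℚᵘ-/ (+ m) 1) (toℚᵘ-/ (+ n) 1) ⟨
  toℚᵘ ⟦ m ⟧ ℚᵘ.+ toℚᵘ ⟦ n ⟧    ≈⟨ toℚᵘ-homo-+ ⟦ m ⟧ ⟦ n ⟧ ⟨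
  toℚᵘ (⟦ m ⟧ + ⟦ n ⟧)          ∎)
  where open ℚᵘ.≃-Reasoning

/-*-cancel : ∀ m n .{{_ : NonZero n}} → (+ m / n) * ⟦ n ⟧ ≡ ⟦ m ⟧
/-*-cancel m n@(suc _) = toℚᵘ-injective (begin
  toℚᵘ ((+ m / n) * ⟦ n ⟧)             ≈⟨ toℚᵘ-homo-* (+ m / n) ⟦ n ⟧ ⟩
  toℚᵘ (+ m / n) ℚᵘ.* toℚᵘ ⟦ n ⟧       ≈⟨ ℚᵘ.*-cong (toℚᵘ-/ (+ m) n) (toℚᵘ-/ (+ n) 1) ⟩
  (+ m ℚᵘ./ n) ℚᵘ.* (+ n ℚᵘ./ 1)       ≈⟨ ℚᵘ.*≡* (trans (ℤ.*-identityʳ _) (cong (λ d → + m ℤ.* + d) (sym (ℕ.*-identityʳ n)))) ⟩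
  + m ℚᵘ./ 1                           ≈⟨ toℚᵘ-/ (+ m) 1 ⟨
  toℚᵘ ⟦ m ⟧                           ∎)
  where open ℚᵘ.≃-Reasoning

⟦⟧-* : ∀ m n → ⟦ m ℕ.* n ⟧ ≡ ⟦ m ⟧ * ⟦ n ⟧
⟦⟧-* zero    n = sym (*-zeroˡ ⟦ n ⟧)
⟦⟧-* (suc m) n = begin
  ⟦ n ℕ.+ m ℕ.* n ⟧         ≡⟨ ⟦⟧-+ n (m ℕ.* n) ⟩
  ⟦ n ⟧ + ⟦ m ℕ.* n ⟧       ≡⟨ cong (_+_ ⟦ n ⟧) (⟦⟧-* m n) ⟩
  ⟦ n ⟧ + ⟦ m ⟧ * ⟦ n ⟧     ≡⟨ eq ⟦ m ⟧ ⟦ n ⟧ ⟩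
  (1ℚ + ⟦ m ⟧) * ⟦ n ⟧      ≡⟨ cong (_* ⟦ n ⟧) (⟦⟧-+ 1 m) ⟨
  ⟦ suc m ⟧ * ⟦ n ⟧         ∎
  where
  open ≡-Reasoning
  eq : ∀ x y → y + x * y ≡ (1ℚ + x) * y
  eq = solve-∀ ring

⟦⟧-^ : ∀ m n → ⟦ m ℕ.^ n ⟧ ≡ ⟦ m ⟧ ^ℚ n
⟦⟧-^ m zero    = refl
⟦⟧-^ m (suc n) = trans (⟦⟧-* m (m ℕ.^ n)) (cong (⟦ m ⟧ *_) (⟦⟧-^ m n))

0≤/ : ∀ m n .{{_ : NonZero n}} → 0ℚ ≤ + m / n
0≤/ m n = nonNegative⁻¹ (+ m / n) {{normalize-nonNeg m n}}

0≤⟦_⟧ : ∀ n → 0ℚ ≤ ⟦ n ⟧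
0≤⟦ n ⟧ = 0≤/ n 1

⟦⟧-mono-≤ : ∀ {m n} → m ℕ.≤ n → ⟦ m ⟧ ≤ ⟦ n ⟧
⟦⟧-mono-≤ {m} {n} m≤n = ≤-by ⟦ n ℕ.∸ m ⟧ 0≤⟦ n ℕ.∸ m ⟧
  (trans (cong ⟦_⟧ (sym (ℕ.m+[n∸m]≡n m≤n))) (⟦⟧-+ m (n ℕ.∸ m)))

*⟦⟧-cancel-≤ : ∀ {p q} n .{{_ : NonZero n}} → p * ⟦ n ⟧ ≤ q * ⟦ n ⟧ → p ≤ q
*⟦⟧-cancel-≤ n = *-cancelʳ-≤-pos ⟦ n ⟧ {{normalize-pos n 1}}

bernoulli : ∀ {x} n → 0ℚ ≤ x → 1ℚ + ⟦ n ⟧ * x ≤ (1ℚ + x) ^ℚ n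
bernoulli {x} zero    0≤x = ≤-reflexive (trans (cong (_+_ 1ℚ) (*-zeroˡ x)) (+-identityʳ 1ℚ))
bernoulli {x} (suc n) 0≤x = ≤-trans
  (≤-by (⟦ n ⟧ * x * x) (*-nonNeg (*-nonNeg 0≤⟦ n ⟧ 0≤x) 0≤x)
    (trans (eq ⟦ n ⟧ x) (cong (λ y → 1ℚ + y * x + ⟦ n ⟧ * x * x) (sym (⟦⟧-+ 1 n)))))
  (*-monoˡ-≤ (1ℚ + x) (+-nonNeg 0≤1 0≤x) (bernoulli n 0≤x))
  where
  eq : ∀ y x → (1ℚ + x) * (1ℚ + y * x) ≡ 1ℚ + (1ℚ + y) * x + y * x * x
  eq = solve-∀ ring

-- Expectations over random subsets

∏-nonNeg : ∀ {n} {x : Fin n → ℚ} → (∀ i → 0ℚ ≤ x i) → 0ℚ ≤ ∏ x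
∏-nonNeg {zero}  0≤x = 0≤1
∏-nonNeg {suc n} 0≤x = *-nonNeg (0≤x zero) (∏-nonNeg (0≤x ∘ suc))

∏-mono-≤ : ∀ {n} {x y : Fin n → ℚ} → (∀ i → 0ℚ ≤ x i) → (∀ i → x i ≤ y i) → ∏ x ≤ ∏ y
∏-mono-≤ {zero}  0≤x x≤y = ≤-refl
∏-mono-≤ {suc n} 0≤x x≤y =
  *-mono-≤ (0≤x zero) (∏-nonNeg (0≤x ∘ suc)) (x≤y zero) (∏-mono-≤ (0≤x ∘ suc) (x≤y ∘ suc))

-- Union bound: the right side is the probability that the random subset is empty.
1-∑≤∏[1-] : ∀ {n} {p : Fin n → ℚ} → (∀ i → 0ℚ ≤ p i) → (∀ i → p i ≤ 1ℚ) →
            1ℚ - ∑ p ≤ ∏ (λ i → 1ℚ - p i)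
1-∑≤∏[1-] {zero}      0≤p p≤1 = ≤-refl
1-∑≤∏[1-] {suc n} {p} 0≤p p≤1 = ≤-trans
  (≤-by (p zero * ∑ (p ∘ suc)) (*-nonNeg (0≤p zero) (∑-nonNeg (0≤p ∘ suc))) (eq (p zero) (∑ (p ∘ suc))))
  (*-monoˡ-≤ (1ℚ - p zero) (p≤q⇒0≤q-p (p≤1 zero)) (1-∑≤∏[1-] (0≤p ∘ suc) (p≤1 ∘ suc)))
  where
  eq : ∀ x s → (1ℚ - x) * (1ℚ - s) ≡ 1ℚ - (x + s) + x * s
  eq = solve-∀ ring
  ∑-nonNeg : ∀ {n} {x : Fin n → ℚ} → (∀ i → 0ℚ ≤ x i) → 0ℚ ≤ ∑ x
  ∑-nonNeg {zero}  0≤x = ≤-refl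
  ∑-nonNeg {suc n} 0≤x = +-nonNeg (0≤x zero) (∑-nonNeg (0≤x ∘ suc))


𝔼-const : ∀ {n} (p : Fin n → ℚ) c → 𝔼-subset p (λ _ → c) ≡ c
𝔼-const {zero}  p c = refl
𝔼-const {suc n} p c = trans
  (cong₂ (λ x y → p zero * x + (1ℚ - p zero) * y) (𝔼-const (p ∘ suc) c) (𝔼-const (p ∘ suc) c))
  (eq (p zero) c)
  where
  eq : ∀ x c → x * c + (1ℚ - x) * c ≡ c
  eq = solve-∀ ring

𝔼-linear : ∀ {n} (p : Fin n → ℚ) a b (f g : Subset n → ℚ) →
           𝔼-subset p (λ S → a * f S + b * g S) ≡ a * 𝔼-subset p f + b * 𝔼-subset p g
𝔼-linear {zero}  p a b f g = refl
𝔼-linear {suc n} p a b f g = trans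
  (cong₂ (λ x y → p zero * x + (1ℚ - p zero) * y) (𝔼-linear (p ∘ suc) a b _ _) (𝔼-linear (p ∘ suc) a b _ _))
  (eq (p zero) a b _ _ _ _)
  where
  eq : ∀ x a b s t u v → x * (a * s + b * t) + (1ℚ - x) * (a * u + b * v) ≡
                         a * (x * s + (1ℚ - x) * u) + b * (x * t + (1ℚ - x) * v)
  eq = solve-∀ ring

𝔼-complement : ∀ {n} (p : Fin n → ℚ) (f : Subset n → ℚ) →
               1ℚ - 𝔼-subset p f ≡ 𝔼-subset p (λ S → 1ℚ - f S)
𝔼-complement {zero}  p f = refl
𝔼-complement {suc n} p f = trans
  (eq (p zero) _ _)
  (cong₂ (λ x y → p zero * x + (1ℚ - p zero) * y) (𝔼-complement (p ∘ suc) _) (𝔼-complement (p ∘ suc) _))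
  where
  eq : ∀ x s t → 1ℚ - (x * s + (1ℚ - x) * t) ≡ x * (1ℚ - s) + (1ℚ - x) * (1ℚ - t)
  eq = solve-∀ ring

𝔼-*ˡ : ∀ {n} (p : Fin n → ℚ) a (f : Subset n → ℚ) →
       𝔼-subset p (λ S → a * f S) ≡ a * 𝔼-subset p f
𝔼-*ˡ {zero}  p a f = refl
𝔼-*ˡ {suc n} p a f = trans
  (cong₂ (λ x y → p zero * x + (1ℚ - p zero) * y) (𝔼-*ˡ (p ∘ suc) a _) (𝔼-*ˡ (p ∘ suc) a _))
  (eq (p zero) a _ _)
  where
  eq : ∀ x a s t → x * (a * s) + (1ℚ - x) * (a * t) ≡ a * (x * s + (1ℚ - x) * t)
  eq = solve-∀ ring

𝔼-mono-≤ : ∀ {n} {p : Fin n → ℚ} {f g : Subset n → ℚ} →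
           (∀ i → 0ℚ ≤ p i) → (∀ i → p i ≤ 1ℚ) → (∀ S → f S ≤ g S) → 𝔼-subset p f ≤ 𝔼-subset p g
𝔼-mono-≤ {zero}      0≤p p≤1 f≤g = f≤g []
𝔼-mono-≤ {suc n} {p} 0≤p p≤1 f≤g = +-mono-≤
  (*-monoˡ-≤ (p zero) (0≤p zero) (𝔼-mono-≤ (0≤p ∘ suc) (p≤1 ∘ suc) (λ S → f≤g _)))
  (*-monoˡ-≤ (1ℚ - p zero) (p≤q⇒0≤q-p (p≤1 zero)) (𝔼-mono-≤ (0≤p ∘ suc) (p≤1 ∘ suc) (λ S → f≤g _)))

-- Serves the case that the first element belongs to the subset. It is then alone exactly if the
-- rest of the subset is `⊥`, and the other factors have a constant product `c`.
𝔼-⊥ : ∀ {n} (p : Fin n → ℚ) a b c →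
      𝔼-subset p (λ S → (if does (S ≟ˢ ⊥) then b else a) * c) ≡
      (a - ∏ (λ i → 1ℚ - p i) * (a - b)) * c
𝔼-⊥ {zero}  p a b c = eq a b c
  where
  eq : ∀ a b c → b * c ≡ (a - 1ℚ * (a - b)) * c
  eq = solve-∀ ring
𝔼-⊥ {suc n} p a b c = trans
  (cong₂ (λ x y → p zero * x + (1ℚ - p zero) * y) (𝔼-const (p ∘ suc) (a * c)) (𝔼-⊥ (p ∘ suc) a b c))
  (eq (p zero) a b c _)
  where
  eq : ∀ x a b c π → x * (a * c) + (1ℚ - x) * ((a - π * (a - b)) * c) ≡
                     (a - (1ℚ - x) * π * (a - b)) * c
  eq = solve-∀ ring

-- At most one factor differs from `X i`, because `S` equals at most one singleton.
reward : ∀ {n} → (X Y : Fin n → ℚ) → Subset n → ℚ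
reward X Y S = ∏ (λ i → if does (S ≟ˢ ⁅ i ⁆) then Y i else X i)

-- ∑ᵢ pᵢ (Xᵢ - Yᵢ) ∏_{j ≠ i} Xⱼ
gain : ∀ {n} → (p X Y : Fin n → ℚ) → ℚ
gain {zero}  p X Y = 0ℚ
gain {suc n} p X Y = p zero * (X zero - Y zero) * ∏ (X ∘ suc) + X zero * gain (p ∘ suc) (X ∘ suc) (Y ∘ suc)

gain-nonNeg : ∀ {n} {p X Y : Fin n → ℚ} → (∀ i → 0ℚ ≤ p i) → (∀ i → 0ℚ ≤ Y i) → (∀ i → Y i ≤ X i) →
              0ℚ ≤ gain p X Y
gain-nonNeg {zero}  0≤p 0≤Y Y≤X = ≤-refl
gain-nonNeg {suc n} {X = X} 0≤p 0≤Y Y≤X = +-nonNeg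
  (*-nonNeg (*-nonNeg (0≤p zero) (p≤q⇒0≤q-p (Y≤X zero))) (∏-nonNeg (0≤X ∘ suc)))
  (*-nonNeg (0≤X zero) (gain-nonNeg (0≤p ∘ suc) (0≤Y ∘ suc) (Y≤X ∘ suc)))
  where
  0≤X : ∀ i → 0ℚ ≤ X i
  0≤X i = ≤-trans (0≤Y i) (Y≤X i)

-- Element `i` is alone with probability `p i` times the product of `1ℚ - p j` over `j ≠ i`.
-- Including `1ℚ - p i` as well only lowers this, and makes the product a common factor of all terms
-- of `gain`.
𝔼-reward≤∏-gain : ∀ {n} {p X Y : Fin n → ℚ} →
  (∀ i → 0ℚ ≤ p i) → (∀ i → p i ≤ 1ℚ) → (∀ i → 0ℚ ≤ Y i) → (∀ i → Y i ≤ X i) →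
  𝔼-subset p (reward X Y) ≤ ∏ X - ∏ (λ i → 1ℚ - p i) * gain p X Y
𝔼-reward≤∏-gain {zero} 0≤p p≤1 0≤Y Y≤X = ≤-refl
𝔼-reward≤∏-gain {suc n} {p} {X} {Y} 0≤p p≤1 0≤Y Y≤X = begin
  x * 𝔼-subset (p ∘ suc) (λ S → (if does (S ≟ˢ ⊥) then Y zero else X zero) * ∏ (X ∘ suc)) +
  (1ℚ - x) * 𝔼-subset (p ∘ suc) (λ S → X zero * reward (X ∘ suc) (Y ∘ suc) S)
    ≡⟨ cong₂ (λ s t → x * s + (1ℚ - x) * t) (𝔼-⊥ (p ∘ suc) (X zero) (Y zero) _) (𝔼-*ˡ (p ∘ suc) (X zero) _) ⟩
  x * ((X zero - Π * (X zero - Y zero)) * ∏ (X ∘ suc)) +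
  (1ℚ - x) * (X zero * 𝔼-subset (p ∘ suc) (reward (X ∘ suc) (Y ∘ suc)))
    ≤⟨ +-monoʳ-≤ (x * ((X zero - Π * (X zero - Y zero)) * ∏ (X ∘ suc))) (*-monoˡ-≤ (1ℚ - x) 0≤1-x (*-monoˡ-≤ (X zero) (≤-trans (0≤Y zero) (Y≤X zero))
         (𝔼-reward≤∏-gain (0≤p ∘ suc) (p≤1 ∘ suc) (0≤Y ∘ suc) (Y≤X ∘ suc)))) ⟩
  x * ((X zero - Π * (X zero - Y zero)) * ∏ (X ∘ suc)) +
  (1ℚ - x) * (X zero * (∏ (X ∘ suc) - Π * gain (p ∘ suc) (X ∘ suc) (Y ∘ suc)))
    ≤⟨ ≤-by (x * (x * Π * (X zero - Y zero) * ∏ (X ∘ suc)))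
         (*-nonNeg (0≤p zero) (*-nonNeg (*-nonNeg (*-nonNeg (0≤p zero) (∏-nonNeg (p≤q⇒0≤q-p ∘ p≤1 ∘ suc)))
           (p≤q⇒0≤q-p (Y≤X zero))) (∏-nonNeg (λ i → ≤-trans (0≤Y (suc i)) (Y≤X (suc i))))))
         (eq x (X zero) (Y zero) Π _ _) ⟩
  ∏ X - (1ℚ - x) * Π * gain p X Y ∎
  where
  open ≤-Reasoning
  x = p zero
  Π = ∏ (λ i → 1ℚ - p (suc i))
  0≤1-x = p≤q⇒0≤q-p (p≤1 zero)
  eq : ∀ x a b π P G → a * P - (1ℚ - x) * π * (x * (a - b) * P + a * G) ≡
       x * ((a - π * (a - b)) * P) + (1ℚ - x) * (a * (P - π * G)) + x * (x * π * (a - b) * P)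
  eq = solve-∀ ring

-- Turns the bound back into a product over stations. The left side is the first-order expansion of
-- the right side in the decrements `δ i`; as `0ℚ ≤ δ i ≤ X i`, the product is at least its
-- first-order expansion.
∏-gain≤∏ : ∀ {n} {r} {p X Y : Fin n → ℚ} → 0ℚ ≤ r → r ≤ 1ℚ →
  (∀ i → 0ℚ ≤ p i) → (∀ i → p i ≤ 1ℚ) → (∀ i → 0ℚ ≤ Y i) → (∀ i → Y i ≤ X i) →
  ∏ X - r * gain p X Y ≤ ∏ (λ i → X i - r * (p i * (X i - Y i)))
∏-gain≤∏ {zero} {r} 0≤r r≤1 0≤p p≤1 0≤Y Y≤X = ≤-reflexive (eq r)
  where
  eq : ∀ r → 1ℚ - r * 0ℚ ≡ 1ℚ
  eq = solve-∀ ring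
∏-gain≤∏ {suc n} {r} {p} {X} {Y} 0≤r r≤1 0≤p p≤1 0≤Y Y≤X = begin
  X zero * P - r * (p zero * d zero * P + X zero * G) ≡⟨ eq₁ (X zero) P r (p zero) (d zero) G ⟩
  X zero * (P - r * G) - δ zero * P                   ≤⟨ +-mono-≤ (*-monoˡ-≤ (X zero) (0≤X zero)
                                                           (∏-gain≤∏ 0≤r r≤1 (0≤p ∘ suc) (p≤1 ∘ suc) (0≤Y ∘ suc) (Y≤X ∘ suc)))
                                                           (neg-antimono-≤ (*-monoˡ-≤ (δ zero) (0≤δ zero) Q≤P)) ⟩
  X zero * Q - δ zero * Q                             ≡⟨ eq₂ (X zero) Q (δ zero) ⟩
  (X zero - δ zero) * Q                               ∎
  where
  open ≤-Reasoning
  d δ : Fin (suc n) → ℚ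
  d i = X i - Y i
  δ i = r * (p i * d i)
  P = ∏ (X ∘ suc)
  G = gain (p ∘ suc) (X ∘ suc) (Y ∘ suc)
  Q = ∏ (λ i → X (suc i) - δ (suc i))
  0≤X : ∀ i → 0ℚ ≤ X i
  0≤X i = ≤-trans (0≤Y i) (Y≤X i)
  0≤d : ∀ i → 0ℚ ≤ d i
  0≤d i = p≤q⇒0≤q-p (Y≤X i)
  0≤δ : ∀ i → 0ℚ ≤ δ i
  0≤δ i = *-nonNeg 0≤r (*-nonNeg (0≤p i) (0≤d i))
  δ≤X : ∀ i → δ i ≤ X i
  δ≤X i = begin
    r * (p i * d i)   ≤⟨ *-mono-≤ 0≤r (*-nonNeg (0≤p i) (0≤d i)) r≤1 (*-monoʳ-≤ (d i) (0≤d i) (p≤1 i)) ⟩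
    1ℚ * (1ℚ * d i)   ≤⟨ ≤-by (Y i) (0≤Y i) (eq₃ (X i) (Y i)) ⟩
    X i               ∎
    where
    eq₃ : ∀ x y → x ≡ 1ℚ * (1ℚ * (x - y)) + y
    eq₃ = solve-∀ ring
  Q≤P : Q ≤ P
  Q≤P = ∏-mono-≤ (λ i → p≤q⇒0≤q-p (δ≤X (suc i)))
                 (λ i → ≤-by (δ (suc i)) (0≤δ (suc i)) (eq₄ (X (suc i)) (δ (suc i))))
    where
    eq₄ : ∀ x δ → x ≡ x - δ + δ
    eq₄ = solve-∀ ring
  eq₁ : ∀ a P r p d G → a * P - r * (p * d * P + a * G) ≡ a * (P - r * G) - r * (p * d) * P
  eq₁ = solve-∀ ring
  eq₂ : ∀ a Q δ → a * Q - δ * Q ≡ (a - δ) * Q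
  eq₂ = solve-∀ ring

¼ : ℚ
¼ = ½ * ½

-- If the transmission probabilities sum to at most 3/4, then a station that
-- transmits is alone with probability at least 1/4.
𝔼-reward≤∏ : ∀ {n} {p X Y : Fin n → ℚ} →
  (∀ i → 0ℚ ≤ p i) → (∀ i → p i ≤ 1ℚ) → (∀ i → 0ℚ ≤ Y i) → (∀ i → Y i ≤ X i) →
  ∑ p ≤ 1ℚ - ¼ → 𝔼-subset p (reward X Y) ≤ ∏ (λ i → X i - ¼ * (p i * (X i - Y i)))
𝔼-reward≤∏ {p = p} {X} {Y} 0≤p p≤1 0≤Y Y≤X ∑p≤¾ = begin
  𝔼-subset p (reward X Y)                      ≤⟨ 𝔼-reward≤∏-gain 0≤p p≤1 0≤Y Y≤X ⟩
  ∏ X - ∏ (λ i → 1ℚ - p i) * gain p X Y        ≤⟨ +-monoʳ-≤ (∏ X) (neg-antimono-≤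
                                                    (*-monoʳ-≤ (gain p X Y) (gain-nonNeg 0≤p 0≤Y Y≤X) ¼≤∏)) ⟩
  ∏ X - ¼ * gain p X Y                         ≤⟨ ∏-gain≤∏ (from-yes (0ℚ ≤? ¼)) (from-yes (¼ ≤? 1ℚ)) 0≤p p≤1 0≤Y Y≤X ⟩
  ∏ (λ i → X i - ¼ * (p i * (X i - Y i)))      ∎
  where
  open ≤-Reasoning
  ¼≤∏ : ¼ ≤ ∏ (λ i → 1ℚ - p i)
  ¼≤∏ = ≤-trans (+-monoʳ-≤ 1ℚ (neg-antimono-≤ ∑p≤¾)) (1-∑≤∏[1-] 0≤p p≤1)

-- The potential

1≤∏ : ∀ {n} {x : Fin n → ℚ} → (∀ i → 1ℚ ≤ x i) → 1ℚ ≤ ∏ x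
1≤∏ {zero}  1≤x = ≤-refl
1≤∏ {suc n} 1≤x = 1≤* (1≤x zero) (1≤∏ (1≤x ∘ suc))

≤∏ : ∀ {n} {x : Fin n → ℚ} → (∀ i → 1ℚ ≤ x i) → ∀ i → x i ≤ ∏ x
≤∏ {suc n} {x} 1≤x zero    = subst (_≤ ∏ x) (*-identityʳ (x zero))
  (*-monoˡ-≤ (x zero) (≤-trans 0≤1 (1≤x zero)) (1≤∏ (1≤x ∘ suc)))
≤∏ {suc n} {x} 1≤x (suc i) = subst (_≤ ∏ x) (*-identityˡ (x (suc i)))
  (*-mono-≤ 0≤1 (≤-trans 0≤1 (1≤x (suc i))) (1≤x zero) (≤∏ (1≤x ∘ suc) i))

1-indicator≤ : ∀ {P : Set} {r} (P? : Dec P) → 0ℚ ≤ r → (¬ P → 1ℚ ≤ r) →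
               1ℚ - (if does P? then 1ℚ else 0ℚ) ≤ r
1-indicator≤ (yes p) 0≤r ¬P⇒1≤r = 0≤r
1-indicator≤ (no ¬p) 0≤r ¬P⇒1≤r = ¬P⇒1≤r ¬p

prob : List ℚ → ℕ → ℚ
prob ps a = txProb ps (active a)

-- If every round a is a success with probability at least prob ps a / 4, then the
-- probability of no success before local round a is at most 1 / growth ps a.
growth : List ℚ → ℕ → ℚ
growth ps zero    = 1ℚ
growth ps (suc a) = growth ps a * (1ℚ + ¼ * prob ps a)

0≤¼ : 0ℚ ≤ ¼
0≤¼ = from-yes (0ℚ ≤? ¼)

module Potential
  (ps : List ℚ) (d : ℕ)
  (0≤p : ∀ a → 0ℚ ≤ prob ps a) (p≤1 : ∀ a → prob ps a ≤ 1ℚ)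
  (p≡0 : ∀ a → d ℕ.≤ a → prob ps a ≡ 0ℚ)
  where

  1≤1+¼p : ∀ a → 1ℚ ≤ 1ℚ + ¼ * prob ps a
  1≤1+¼p a = ≤-by (¼ * prob ps a) (*-nonNeg 0≤¼ (0≤p a)) refl

  1≤growth : ∀ a → 1ℚ ≤ growth ps a
  1≤growth zero    = ≤-refl
  1≤growth (suc a) = 1≤* (1≤growth a) (1≤1+¼p a)

  0≤growth : ∀ a → 0ℚ ≤ growth ps a
  0≤growth a = ≤-trans 0≤1 (1≤growth a)

  growth-mono-≤ : ∀ {a b} → a ℕ.≤ b → growth ps a ≤ growth ps b
  growth-mono-≤ = go ∘ ℕ.≤⇒≤′
    where
    go : ∀ {a b} → a ℕ.≤′ b → growth ps a ≤ growth ps b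
    go (ℕ.≤′-reflexive refl) = ≤-refl
    go {a} {suc b} (ℕ.≤′-step a≤b) = subst (_≤ growth ps (suc b)) (*-identityʳ (growth ps a))
      (*-mono-≤ (0≤growth a) 0≤1 (go a≤b) (1≤1+¼p b))

  0≤txProb : ∀ s → 0ℚ ≤ txProb ps s
  0≤txProb asleep        = ≤-refl
  0≤txProb (active a)    = 0≤p a
  0≤txProb (delivered a) = ≤-refl

  txProb≤1 : ∀ s → txProb ps s ≤ 1ℚ
  txProb≤1 asleep        = 0≤1
  txProb≤1 (active a)    = p≤1 a
  txProb≤1 (delivered a) = 0≤1

  module _ {ψ : ℚ} (0≤ψ : 0ℚ ≤ ψ) where

    -- A late success counts as no success; it has probability 0.
    weight : Status → ℚ
    weight asleep        = 1ℚ + ψ * growth ps 0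
    weight (active a)    = 1ℚ + ψ * growth ps a
    weight (delivered a) = if does (a ℕ.≤? d) then 1ℚ else 1ℚ + ψ * growth ps a

    1≤1+ψgrowth : ∀ a → 1ℚ ≤ 1ℚ + ψ * growth ps a
    1≤1+ψgrowth a = ≤-by (ψ * growth ps a) (*-nonNeg 0≤ψ (0≤growth a)) refl

    1≤weight : ∀ s → 1ℚ ≤ weight s
    1≤weight asleep        = 1≤1+ψgrowth 0
    1≤weight (active a)    = 1≤1+ψgrowth a
    1≤weight (delivered a) with does (a ℕ.≤? d)
    ... | true  = ≤-refl
    ... | false = 1≤1+ψgrowth a

    0≤weight : ∀ s → 0ℚ ≤ weight s
    0≤weight s = ≤-trans 0≤1 (1≤weight s)

    weight-failed weight-succeeded : Status → ℚ
    weight-failed asleep           = weight asleep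
    weight-failed (active a)       = weight (active (suc a))
    weight-failed (delivered a)    = weight (delivered a)
    weight-succeeded asleep        = weight asleep
    weight-succeeded (active a)    = weight (delivered (suc a))
    weight-succeeded (delivered a) = weight (delivered a)

    -- A station has the same weight asleep and freshly activated, so the choice of the adversary in
    -- this round does not affect the weights.
    weight-advance : ∀ {k} (r : Round k) i s → weight (advance r i s) ≡
      (if does (transmitters r ≟ˢ ⁅ i ⁆) then weight-succeeded s else weight-failed s)
    weight-advance r i asleep        = trans (awake (does (i ∈? activated r))) (sym (const (does (transmitters r ≟ˢ ⁅ i ⁆))))
      where
      awake : ∀ b → weight (if b then active 0 else asleep) ≡ weight asleep
      awake true  = refl
      awake false = refl
      const : ∀ b → (if b then weight asleep else weight asleep) ≡ weight asleep
      const true  = refl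
      const false = refl
    weight-advance r i (active a)    with does (transmitters r ≟ˢ ⁅ i ⁆)
    ... | true  = refl
    ... | false = refl
    weight-advance r i (delivered a) with does (transmitters r ≟ˢ ⁅ i ⁆)
    ... | true  = refl
    ... | false = refl

    succeeded≤failed : ∀ s → weight-succeeded s ≤ weight-failed s
    succeeded≤failed asleep        = ≤-refl
    succeeded≤failed (active a)    with does (suc a ℕ.≤? d)
    ... | true  = 1≤1+ψgrowth (suc a)
    ... | false = ≤-refl
    succeeded≤failed (delivered a) = ≤-refl

    -- While a success still counts, the left side for an active station is
    -- `1ℚ + ψ * g * (1ℚ + ¼ * p) * (1ℚ - ¼ * p)`: the chance of a reset to 1 outweighs the growth
    -- by a second-order term.
    expected-weight : ∀ s → weight-failed s - ¼ * (txProb ps s * (weight-failed s - weight-succeeded s)) ≤ weight s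
    expected-weight asleep        = ≤-reflexive (eq (weight asleep))
      where
      eq : ∀ x → x - ¼ * (0ℚ * (x - x)) ≡ x
      eq = solve-∀ ring
    expected-weight (delivered a) = ≤-reflexive (eq (weight (delivered a)))
      where
      eq : ∀ x → x - ¼ * (0ℚ * (x - x)) ≡ x
      eq = solve-∀ ring
    -- `a <ᵇ d` is what `suc a ≤? d` computes to: it decides whether a success in the next local
    -- round, `suc a`, is in time.
    expected-weight (active a)    with a ℕ.<ᵇ d in a<ᵇd
    ... | true  = ≤-by (ψ * g * (¼ * p * (¼ * p)))
                      (*-nonNeg (*-nonNeg 0≤ψ (0≤growth a)) (*-nonNeg 0≤¼p 0≤¼p)) (eq ψ g p ¼)
      where
      g = growth ps a
      p = prob ps a
      0≤¼p = *-nonNeg 0≤¼ (0≤p a)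
      eq : ∀ ψ g p q → 1ℚ + ψ * g ≡
           (1ℚ + ψ * (g * (1ℚ + q * p))) - q * (p * ((1ℚ + ψ * (g * (1ℚ + q * p))) - 1ℚ)) + ψ * g * (q * p * (q * p))
      eq = solve-∀ ring
    -- A late success would leave the weight as it is, but the transmission probability is 0 here,
    -- so the weight does not grow either.
    ... | false rewrite p≡0 a (ℕ.≮⇒≥ (λ a<d → subst T a<ᵇd (ℕ.<⇒<ᵇ a<d))) = ≤-reflexive (eq ψ (growth ps a) ¼)
      where
      eq : ∀ ψ g q → (1ℚ + ψ * (g * (1ℚ + q * 0ℚ))) - q * (0ℚ * ((1ℚ + ψ * (g * (1ℚ + q * 0ℚ))) - (1ℚ + ψ * (g * (1ℚ + q * 0ℚ))))) ≡ 1ℚ + ψ * g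
      eq = solve-∀ ring

    late-weight : ∀ s → ¬ OnTime d s → 1ℚ + ψ * growth ps d ≤ weight s
    late-weight asleep        late = contradiction tt late
    late-weight (active a)    late = +-monoʳ-≤ 1ℚ (*-monoˡ-≤ ψ 0≤ψ (growth-mono-≤ (ℕ.≮⇒≥ late)))
    late-weight (delivered a) late with a ℕ.≤ᵇ d in a≤ᵇd
    ... | true  = contradiction (ℕ.≤ᵇ⇒≤ a d (subst T (sym a≤ᵇd) tt)) late
    ... | false = +-monoʳ-≤ 1ℚ (*-monoˡ-≤ ψ 0≤ψ (growth-mono-≤ (ℕ.≰⇒≥ late)))

    totalWeight : ∀ {k} → History k → ℚ
    totalWeight h = ∏ (λ i → weight (status h i))

    1≤totalWeight : ∀ {k} (h : History k) → 1ℚ ≤ totalWeight h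
    1≤totalWeight h = 1≤∏ (λ i → 1≤weight (status h i))

    late-totalWeight : ∀ {k} (h : History k) → ¬ AllOnTime d h → 1ℚ + ψ * growth ps d ≤ totalWeight h
    late-totalWeight h late with ¬∀⟶∃¬ _ _ (λ i → onTime? d (status h i)) late
    ... | i , late-i = ≤-trans (late-weight (status h i) late-i) (≤∏ (λ i → 1≤weight (status h i)) i)

    -- The history `h` is fixed, so `A h` is a constant within the round and only the transmitters
    -- are random; this is why adaptivity does not help the adversary.
    totalWeight-supermartingale : ∀ {k} (A : Adversary k) h → ∑ (λ i → txProb ps (status h i)) ≤ 1ℚ - ¼ →
      𝔼-subset (λ i → txProb ps (status h i)) (λ S → totalWeight (round (A h) S ∷ h)) ≤ totalWeight h
    totalWeight-supermartingale A h ∑p≤¾ = begin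
      𝔼-subset p (λ S → totalWeight (round (A h) S ∷ h))
        ≤⟨ 𝔼-mono-≤ 0≤p′ p≤1′ (λ S → ∏-mono-≤ (λ i → 0≤weight (advance (round (A h) S) i (status h i)))
             (λ i → ≤-reflexive (weight-advance (round (A h) S) i (status h i)))) ⟩
      𝔼-subset p (reward X Y)
        ≤⟨ 𝔼-reward≤∏ 0≤p′ p≤1′ 0≤Y Y≤X ∑p≤¾ ⟩
      ∏ (λ i → X i - ¼ * (p i * (X i - Y i)))
        ≤⟨ ∏-mono-≤ 0≤Z (λ i → expected-weight (status h i)) ⟩
      totalWeight h ∎
      where
      open ≤-Reasoning
      p X Y : Fin _ → ℚ
      p i = txProb ps (status h i)
      X i = weight-failed (status h i)
      Y i = weight-succeeded (status h i)
      0≤p′ : ∀ i → 0ℚ ≤ p i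
      0≤p′ i = 0≤txProb (status h i)
      p≤1′ : ∀ i → p i ≤ 1ℚ
      p≤1′ i = txProb≤1 (status h i)
      1≤succeeded : ∀ s → 1ℚ ≤ weight-succeeded s
      1≤succeeded asleep        = 1≤weight asleep
      1≤succeeded (active a)    = 1≤weight (delivered (suc a))
      1≤succeeded (delivered a) = 1≤weight (delivered a)
      0≤Y : ∀ i → 0ℚ ≤ Y i
      0≤Y i = ≤-trans 0≤1 (1≤succeeded (status h i))
      Y≤X : ∀ i → Y i ≤ X i
      Y≤X i = succeeded≤failed (status h i)
      0≤Z : ∀ i → 0ℚ ≤ X i - ¼ * (p i * (X i - Y i))
      0≤Z i = p≤q⇒0≤q-p (begin
        ¼ * (p i * (X i - Y i))    ≤⟨ *-mono-≤ 0≤¼ (*-nonNeg (0≤p′ i) 0≤d) (from-yes (¼ ≤? 1ℚ)) (*-monoʳ-≤ (X i - Y i) 0≤d (p≤1′ i)) ⟩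
        1ℚ * (1ℚ * (X i - Y i))    ≤⟨ ≤-by (Y i) (0≤Y i) (eq (X i) (Y i)) ⟩
        X i                        ∎)
        where
        0≤d = p≤q⇒0≤q-p (Y≤X i)
        eq : ∀ x y → x ≡ 1ℚ * (1ℚ * (x - y)) + y
        eq = solve-∀ ring

  -- As long as the channel is not overloaded, both total weights are supermartingales;
  -- an overload is paid for by the first, a late station by the second.
  module _ {k} (A : Adversary k) {ψ₁ ψ₂ α β : ℚ} (0≤ψ₁ : 0ℚ ≤ ψ₁) (0≤ψ₂ : 0ℚ ≤ ψ₂) (0≤α : 0ℚ ≤ α) (0≤β : 0ℚ ≤ β)
    (overloaded : ∀ (h : History k) → ¬ (∑ (λ i → txProb ps (status h i)) ≤ 1ℚ - ¼) → 1ℚ ≤ α * totalWeight 0≤ψ₁ h)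
    (late : 1ℚ ≤ β * (1ℚ + ψ₂ * growth ps d))
    where

    risk : History k → ℚ
    risk h = α * totalWeight 0≤ψ₁ h + β * totalWeight 0≤ψ₂ h

    indicator : History k → ℚ
    indicator h = if does (allOnTime? d h) then 1ℚ else 0ℚ

    0≤α*W : ∀ (h : History k) → 0ℚ ≤ α * totalWeight 0≤ψ₁ h
    0≤α*W h = *-nonNeg 0≤α (≤-trans 0≤1 (1≤totalWeight 0≤ψ₁ h))

    0≤β*W : ∀ (h : History k) → 0ℚ ≤ β * totalWeight 0≤ψ₂ h
    0≤β*W h = *-nonNeg 0≤β (≤-trans 0≤1 (1≤totalWeight 0≤ψ₂ h))

    0≤𝔼-run : ∀ T h → 0ℚ ≤ 𝔼-run ps A T indicator h
    0≤𝔼-run zero    h with does (allOnTime? d h)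
    ... | true  = 0≤1
    ... | false = ≤-refl
    0≤𝔼-run (suc T) h = ≤-trans (≤-reflexive (sym (𝔼-const (λ i → txProb ps (status h i)) 0ℚ)))
      (𝔼-mono-≤ (λ i → 0≤txProb (status h i)) (λ i → txProb≤1 (status h i)) (λ S → 0≤𝔼-run T _))

    𝔼-run≤1 : ∀ T h → 𝔼-run ps A T indicator h ≤ 1ℚ
    𝔼-run≤1 zero    h with does (allOnTime? d h)
    ... | true  = ≤-refl
    ... | false = 0≤1
    𝔼-run≤1 (suc T) h = ≤-trans
      (𝔼-mono-≤ (λ i → 0≤txProb (status h i)) (λ i → txProb≤1 (status h i)) (λ S → 𝔼-run≤1 T _))
      (≤-reflexive (𝔼-const (λ i → txProb ps (status h i)) 1ℚ))

    -- Backward induction takes the place of a stopping time. At an overloaded history the risk is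
    -- already at least 1 and the bound is trivial; otherwise one more round does not increase the
    -- expected risk.
    1-𝔼-run≤risk : ∀ T h → 1ℚ - 𝔼-run ps A T indicator h ≤ risk h
    1-𝔼-run≤risk zero    h = 1-indicator≤ (allOnTime? d h)
      (+-nonNeg (0≤α*W h) (0≤β*W h))
      (λ ¬ok → +-mono-≤ (0≤α*W h) (≤-trans late (*-monoˡ-≤ β 0≤β (late-totalWeight 0≤ψ₂ h ¬ok))))
    1-𝔼-run≤risk (suc T) h with ∑ (λ i → txProb ps (status h i)) ≤? 1ℚ - ¼
    ... | no  heavy = begin
      1ℚ - 𝔼-run ps A (suc T) indicator h ≤⟨ +-monoʳ-≤ 1ℚ (neg-antimono-≤ (0≤𝔼-run (suc T) h)) ⟩
      1ℚ + 0ℚ                             ≤⟨ +-mono-≤ (overloaded h heavy) (0≤β*W h) ⟩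
      risk h                              ∎
      where open ≤-Reasoning
    ... | yes light = begin
      1ℚ - 𝔼-run ps A (suc T) indicator h ≡⟨ 𝔼-complement p _ ⟩
      𝔼-subset p (λ S → 1ℚ - 𝔼-run ps A T indicator (next S))
        ≤⟨ 𝔼-mono-≤ (λ i → 0≤txProb (status h i)) (λ i → txProb≤1 (status h i)) (λ S → 1-𝔼-run≤risk T (next S)) ⟩
      𝔼-subset p (risk ∘ next)            ≡⟨ 𝔼-linear p α β _ _ ⟩
      α * 𝔼-subset p (totalWeight 0≤ψ₁ ∘ next) + β * 𝔼-subset p (totalWeight 0≤ψ₂ ∘ next)
        ≤⟨ +-mono-≤ (*-monoˡ-≤ α 0≤α (totalWeight-supermartingale 0≤ψ₁ A h light))
                    (*-monoˡ-≤ β 0≤β (totalWeight-supermartingale 0≤ψ₂ A h light)) ⟩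
      risk h ∎
      where
      open ≤-Reasoning
      p : Fin k → ℚ
      p i = txProb ps (status h i)
      next : Subset k → History k
      next S = round (A h) S ∷ h

-- Numerical estimates

2⌊n/2⌋≤n : ∀ n → 2 ℕ.* ⌊ n /2⌋ ℕ.≤ n
2⌊n/2⌋≤n n = begin
  2 ℕ.* ⌊ n /2⌋              ≡⟨ cong (⌊ n /2⌋ ℕ.+_) (ℕ.+-identityʳ ⌊ n /2⌋) ⟩
  ⌊ n /2⌋ ℕ.+ ⌊ n /2⌋        ≤⟨ ℕ.+-monoʳ-≤ ⌊ n /2⌋ (ℕ.⌊n/2⌋≤⌈n/2⌉ n) ⟩
  ⌊ n /2⌋ ℕ.+ ⌈ n /2⌉        ≡⟨ ℕ.⌊n/2⌋+⌈n/2⌉≡n n ⟩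
  n                          ∎
  where open ℕ.≤-Reasoning

n≤2⌈n/2⌉ : ∀ n → n ℕ.≤ 2 ℕ.* ⌈ n /2⌉
n≤2⌈n/2⌉ n = begin
  n                          ≡⟨ ℕ.⌊n/2⌋+⌈n/2⌉≡n n ⟨
  ⌊ n /2⌋ ℕ.+ ⌈ n /2⌉        ≤⟨ ℕ.+-monoˡ-≤ ⌈ n /2⌉ (ℕ.⌊n/2⌋≤⌈n/2⌉ n) ⟩
  ⌈ n /2⌉ ℕ.+ ⌈ n /2⌉        ≡⟨ cong (⌈ n /2⌉ ℕ.+_) (ℕ.+-identityʳ ⌈ n /2⌉) ⟨
  2 ℕ.* ⌈ n /2⌉              ∎
  where open ℕ.≤-Reasoning

-- The induction follows the accessibility proof along which `⌈log2⌉` itself recurses.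
n≤2^⌈log₂n⌉ : ∀ n → n ℕ.≤ 2 ℕ.^ ⌈log₂ n ⌉
n≤2^⌈log₂n⌉ n = go n (<-wellFounded n)
  where
  go : ∀ n (ac : Acc ℕ._<_ n) → n ℕ.≤ 2 ℕ.^ ⌈log2⌉ n ac
  go 0             _        = z≤n
  go 1             _        = ℕ.≤-refl
  go (suc (suc n)) (acc rs) = begin
    2 ℕ.+ n                          ≤⟨ ℕ.+-monoʳ-≤ 2 (n≤2⌈n/2⌉ n) ⟩
    2 ℕ.+ 2 ℕ.* ⌈ n /2⌉              ≡⟨ ℕ.*-suc 2 ⌈ n /2⌉ ⟨
    2 ℕ.* suc ⌈ n /2⌉                ≤⟨ ℕ.*-monoʳ-≤ 2 (go (suc ⌈ n /2⌉) _) ⟩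
    2 ℕ.* 2 ℕ.^ ⌈log2⌉ (suc ⌈ n /2⌉) _ ∎
    where open ℕ.≤-Reasoning

-- With `m = suc n`, the bound `2 * (m - 1)` survives the induction where `2 * m` would not: halving
-- rounds `m` up, but `m - 1` down.
2^⌈log₂[1+n]⌉≤2n : ∀ n .{{_ : NonZero n}} → 2 ℕ.^ ⌈log₂ suc n ⌉ ℕ.≤ 2 ℕ.* n
2^⌈log₂[1+n]⌉≤2n (suc n) = go n (<-wellFounded (suc (suc n)))
  where
  go : ∀ n (ac : Acc ℕ._<_ (suc (suc n))) → 2 ℕ.^ ⌈log2⌉ (suc (suc n)) ac ℕ.≤ 2 ℕ.* suc n
  go zero    (acc rs) = ℕ.≤-refl
  go (suc n) (acc rs) = ℕ.*-monoʳ-≤ 2 (begin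
    2 ℕ.^ ⌈log2⌉ (suc (suc ⌊ n /2⌋)) (rs _)  ≤⟨ go ⌊ n /2⌋ (rs _) ⟩
    2 ℕ.* suc ⌊ n /2⌋                   ≡⟨ ℕ.*-suc 2 ⌊ n /2⌋ ⟩
    2 ℕ.+ 2 ℕ.* ⌊ n /2⌋                 ≤⟨ ℕ.+-monoʳ-≤ 2 (2⌊n/2⌋≤n n) ⟩
    2 ℕ.+ n                             ∎)
    where open ℕ.≤-Reasoning

2^⌈log₂n⌉≤2n : ∀ n .{{_ : NonZero n}} → 2 ℕ.^ ⌈log₂ n ⌉ ℕ.≤ 2 ℕ.* n
2^⌈log₂n⌉≤2n 1             = s≤s z≤n
2^⌈log₂n⌉≤2n (suc (suc n)) = ℕ.≤-trans (2^⌈log₂[1+n]⌉≤2n (suc n)) (ℕ.*-monoʳ-≤ 2 (ℕ.n≤1+n (suc n)))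

n<2^n : ∀ n → n ℕ.< 2 ℕ.^ n
n<2^n zero    = s≤s z≤n
n<2^n (suc n) = begin
  2 ℕ.+ n                ≤⟨ ℕ.+-mono-≤ (s≤s {n = n} z≤n) (n<2^n n) ⟩
  suc n ℕ.+ 2 ℕ.^ n      ≤⟨ ℕ.+-monoˡ-≤ (2 ℕ.^ n) (n<2^n n) ⟩
  2 ℕ.^ n ℕ.+ 2 ℕ.^ n    ≡⟨ cong (2 ℕ.^ n ℕ.+_) (ℕ.+-identityʳ (2 ℕ.^ n)) ⟨
  2 ℕ.* 2 ℕ.^ n          ∎
  where open ℕ.≤-Reasoning

2n≤2^n : ∀ n .{{_ : NonZero n}} → 2 ℕ.* n ℕ.≤ 2 ℕ.^ n
2n≤2^n (suc n) = ℕ.*-monoʳ-≤ 2 (n<2^n n)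

n²≤2*2^n : ∀ n → n ℕ.* n ℕ.≤ 2 ℕ.* 2 ℕ.^ n
n²≤2*2^n 0 = z≤n
n²≤2*2^n 1 = s≤s z≤n
n²≤2*2^n 2 = ℕ.m≤m+n 4 4
n²≤2*2^n 3 = ℕ.m≤m+n 9 7
n²≤2*2^n (suc n@(suc (suc (suc m)))) = begin
  suc n ℕ.* suc n                                          ≤⟨ ℕ.m≤m+n _ (2 ℕ.+ 4 ℕ.* m ℕ.+ m ℕ.* m) ⟩
  suc n ℕ.* suc n ℕ.+ (2 ℕ.+ 4 ℕ.* m ℕ.+ m ℕ.* m)          ≡⟨ eq m ⟩
  2 ℕ.* (n ℕ.* n)                                          ≤⟨ ℕ.*-monoʳ-≤ 2 (n²≤2*2^n n) ⟩
  2 ℕ.* (2 ℕ.* 2 ℕ.^ n)                                    ∎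
  where
  open ℕ.≤-Reasoning
  eq : ∀ m → (4 ℕ.+ m) ℕ.* (4 ℕ.+ m) ℕ.+ (2 ℕ.+ 4 ℕ.* m ℕ.+ m ℕ.* m) ≡ 2 ℕ.* ((3 ℕ.+ m) ℕ.* (3 ℕ.+ m))
  eq = solveℕ-∀

2≤[1+x]^n : ∀ {x} n → 0ℚ ≤ x → 1ℚ ≤ ⟦ n ⟧ * x → ⟦ 2 ⟧ ≤ (1ℚ + x) ^ℚ n
2≤[1+x]^n n 0≤x 1≤nx = ≤-trans (+-monoʳ-≤ 1ℚ 1≤nx) (bernoulli n 0≤x)

-- Converse of `bernoulli` up to a factor 2. The quadratic term `x * y` of the induction step is at
-- most `x` as long as the linear term `y` is at most 1.
[1+x]^n≤1+2nx : ∀ {x} n → 0ℚ ≤ x → ⟦ 2 ⟧ * ⟦ n ⟧ * x ≤ 1ℚ → (1ℚ + x) ^ℚ n ≤ 1ℚ + ⟦ 2 ⟧ * ⟦ n ⟧ * x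
[1+x]^n≤1+2nx {x} zero    0≤x _     = ≤-reflexive (eq x)
  where
  eq : ∀ x → 1ℚ ≡ 1ℚ + ⟦ 2 ⟧ * 0ℚ * x
  eq = solve-∀ ring
[1+x]^n≤1+2nx {x} (suc n) 0≤x 2nx≤1 = begin
  (1ℚ + x) * (1ℚ + x) ^ℚ n                        ≤⟨ *-monoˡ-≤ (1ℚ + x) (+-nonNeg 0≤1 0≤x) ([1+x]^n≤1+2nx n 0≤x y≤1) ⟩
  (1ℚ + x) * (1ℚ + y)                             ≤⟨ ≤-by (x * (1ℚ - y)) (*-nonNeg 0≤x (p≤q⇒0≤q-p y≤1)) (eq₁ x y) ⟩
  1ℚ + (y + ⟦ 2 ⟧ * x)                            ≡⟨ cong (_+_ 1ℚ) eq₃ ⟨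
  1ℚ + ⟦ 2 ⟧ * ⟦ suc n ⟧ * x                      ∎
  where
  open ≤-Reasoning
  y = ⟦ 2 ⟧ * ⟦ n ⟧ * x
  eq₁ : ∀ x y → 1ℚ + (y + ⟦ 2 ⟧ * x) ≡ (1ℚ + x) * (1ℚ + y) + x * (1ℚ - y)
  eq₁ = solve-∀ ring
  eq₂ : ∀ x m → ⟦ 2 ⟧ * (1ℚ + m) * x ≡ ⟦ 2 ⟧ * m * x + ⟦ 2 ⟧ * x
  eq₂ = solve-∀ ring
  eq₃ : ⟦ 2 ⟧ * ⟦ suc n ⟧ * x ≡ y + ⟦ 2 ⟧ * x
  eq₃ = trans (cong (λ m → ⟦ 2 ⟧ * m * x) (⟦⟧-+ 1 n)) (eq₂ x ⟦ n ⟧)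
  y≤1 : y ≤ 1ℚ
  y≤1 = ≤-trans (≤-by (⟦ 2 ⟧ * x) (*-nonNeg 0≤⟦ 2 ⟧ 0≤x) eq₃) 2nx≤1

-- With `t` for the power of 3, each of the terms `y`, `t * y` and `t * y * y` of the next product
-- is at most `t * y`; hence the base 3. For constant `n` the increment stays linear in `y`.
[1+y]^n≤1+3^ny : ∀ {y} n → 0ℚ ≤ y → y ≤ 1ℚ → (1ℚ + y) ^ℚ n ≤ 1ℚ + ⟦ 3 ⟧ ^ℚ n * y
[1+y]^n≤1+3^ny {y} zero    0≤y y≤1 = ≤-by (1ℚ * y) (*-nonNeg 0≤1 0≤y) refl
[1+y]^n≤1+3^ny {y} (suc n) 0≤y y≤1 = begin
  (1ℚ + y) * (1ℚ + y) ^ℚ n        ≤⟨ *-monoˡ-≤ (1ℚ + y) (+-nonNeg 0≤1 0≤y) ([1+y]^n≤1+3^ny n 0≤y y≤1) ⟩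
  (1ℚ + y) * (1ℚ + t * y)         ≤⟨ ≤-by (y * (t - 1ℚ) + t * y * (1ℚ - y))
                                       (+-nonNeg (*-nonNeg 0≤y (p≤q⇒0≤q-p 1≤t))
                                                 (*-nonNeg (*-nonNeg (≤-trans 0≤1 1≤t) 0≤y) (p≤q⇒0≤q-p y≤1)))
                                       (eq y t) ⟩
  1ℚ + ⟦ 3 ⟧ * t * y              ∎
  where
  open ≤-Reasoning
  t = ⟦ 3 ⟧ ^ℚ n
  1≤t : 1ℚ ≤ t
  1≤t = 1≤^ n (⟦⟧-mono-≤ {1} {3} (s≤s z≤n))
  eq : ∀ y t → 1ℚ + ⟦ 3 ⟧ * t * y ≡ (1ℚ + y) * (1ℚ + t * y) + (y * (t - 1ℚ) + t * y * (1ℚ - y))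
  eq = solve-∀ ring

-- The schedule

prob-++ˡ : ∀ ps qs {a} → a ℕ.< length ps → prob (ps ++ qs) a ≡ prob ps a
prob-++ˡ (p ∷ ps) qs {zero}  _         = refl
prob-++ˡ (p ∷ ps) qs {suc a} (s≤s a<n) = prob-++ˡ ps qs a<n

prob-++ʳ : ∀ ps qs a → prob (ps ++ qs) (length ps ℕ.+ a) ≡ prob qs a
prob-++ʳ []       qs a = refl
prob-++ʳ (p ∷ ps) qs a = prob-++ʳ ps qs a

prob-replicate : ∀ {n} p {a} → a ℕ.< n → prob (replicate n p) a ≡ p
prob-replicate {suc n} p {zero}  _         = refl
prob-replicate {suc n} p {suc a} (s≤s a<n) = prob-replicate p a<n

prob-≥length : ∀ ps {a} → length ps ℕ.≤ a → prob ps a ≡ 0ℚ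
prob-≥length []       {zero}  _         = refl
prob-≥length []       {suc a} _         = refl
prob-≥length (p ∷ ps) {suc a} (s≤s n≤a) = prob-≥length ps n≤a

growth-++ˡ : ∀ ps qs {a} → a ℕ.≤ length ps → growth (ps ++ qs) a ≡ growth ps a
growth-++ˡ ps qs {zero}  _   = refl
growth-++ˡ ps qs {suc a} a<n =
  cong₂ (λ g p → g * (1ℚ + ¼ * p)) (growth-++ˡ ps qs (ℕ.<⇒≤ a<n)) (prob-++ˡ ps qs a<n)

growth-++ʳ : ∀ ps qs a → growth (ps ++ qs) (length ps ℕ.+ a) ≡ growth ps (length ps) * growth qs a
growth-++ʳ ps qs zero    = begin
  growth (ps ++ qs) (length ps ℕ.+ 0)     ≡⟨ cong (growth (ps ++ qs)) (ℕ.+-identityʳ (length ps)) ⟩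
  growth (ps ++ qs) (length ps)           ≡⟨ growth-++ˡ ps qs ℕ.≤-refl ⟩
  growth ps (length ps)                   ≡⟨ *-identityʳ _ ⟨
  growth ps (length ps) * 1ℚ              ∎
  where open ≡-Reasoning
growth-++ʳ ps qs (suc a) = begin
  growth (ps ++ qs) (length ps ℕ.+ suc a)                        ≡⟨ cong (growth (ps ++ qs)) (ℕ.+-suc (length ps) a) ⟩
  growth (ps ++ qs) (suc (length ps ℕ.+ a))                      ≡⟨ cong₂ (λ g p → g * (1ℚ + ¼ * p)) (growth-++ʳ ps qs a) (prob-++ʳ ps qs a) ⟩
  growth ps (length ps) * growth qs a * (1ℚ + ¼ * prob qs a)     ≡⟨ *-assoc (growth ps (length ps)) (growth qs a) _ ⟩
  growth ps (length ps) * growth qs (suc a)                      ∎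
  where open ≡-Reasoning

growth-replicate : ∀ {n} p {a} → a ℕ.≤ n → growth (replicate n p) a ≡ (1ℚ + ¼ * p) ^ℚ a
growth-replicate p {zero}  _   = refl
growth-replicate p {suc a} a<n = trans
  (cong₂ (λ g p → g * (1ℚ + ¼ * p)) (growth-replicate p (ℕ.<⇒≤ a<n)) (prob-replicate p a<n))
  (*-comm _ (1ℚ + ¼ * p))

k≤⌈k/2^l⌉*2^l : ∀ k l → k ℕ.≤ ⌈ k /2^ l ⌉ ℕ.* 2 ℕ.^ l
k≤⌈k/2^l⌉*2^l k l = ℕ.+-cancelˡ-≤ (D ℕ.∸ 1) k _ (begin
  (D ℕ.∸ 1) ℕ.+ k            ≡⟨ ℕ.+-comm (D ℕ.∸ 1) k ⟩
  x                          ≡⟨ ℕ.m≡m%n+[m/n]*n x D ⟩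
  x ℕ.% D ℕ.+ x ℕ./ D ℕ.* D  ≤⟨ ℕ.+-monoˡ-≤ (x ℕ./ D ℕ.* D) (ℕ.<⇒≤pred (ℕ.m%n<n x D)) ⟩
  (D ℕ.∸ 1) ℕ.+ x ℕ./ D ℕ.* D ∎)
  where
  open ℕ.≤-Reasoning
  D = 2 ℕ.^ l
  x = k ℕ.+ (D ℕ.∸ 1)
  instance _ = ℕ.m^n≢0 2 l

-- Rounding up costs at most one when the phase length is halved, so the geometric sum of the
-- lengths survives the rounding.
2⌈k/2^[1+l]⌉≤⌈k/2^l⌉+1 : ∀ k l → 2 ℕ.* ⌈ k /2^ suc l ⌉ ℕ.≤ ⌈ k /2^ l ⌉ ℕ.+ 1
2⌈k/2^[1+l]⌉≤⌈k/2^l⌉+1 k l = ℕ.≤-pred (ℕ.*-cancelʳ-< D (2 ℕ.* a′) (suc (a ℕ.+ 1)) (begin-strict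
  2 ℕ.* a′ ℕ.* D                        ≡⟨ eq₁ a′ D ⟩
  a′ ℕ.* (2 ℕ.* D)                      ≤⟨ ℕ.m/n*n≤m (k ℕ.+ (2 ℕ.* D ℕ.∸ 1)) (2 ℕ.* D) ⟩
  k ℕ.+ (2 ℕ.* D ℕ.∸ 1)                 <⟨ ℕ.+-monoʳ-< k (ℕ.≤-reflexive (ℕ.suc-pred (2 ℕ.* D))) ⟩
  k ℕ.+ 2 ℕ.* D                         ≤⟨ ℕ.+-monoˡ-≤ (2 ℕ.* D) (k≤⌈k/2^l⌉*2^l k l) ⟩
  a ℕ.* D ℕ.+ 2 ℕ.* D                   ≡⟨ eq₂ a D ⟩
  suc (a ℕ.+ 1) ℕ.* D                   ∎))
  where
  open ℕ.≤-Reasoning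
  D = 2 ℕ.^ l
  a = ⌈ k /2^ l ⌉
  a′ = ⌈ k /2^ suc l ⌉
  instance _ = ℕ.m^n≢0 2 (suc l)
  eq₁ : ∀ a D → 2 ℕ.* a ℕ.* D ≡ a ℕ.* (2 ℕ.* D)
  eq₁ = solveℕ-∀
  eq₂ : ∀ a D → a ℕ.* D ℕ.+ 2 ℕ.* D ≡ suc (a ℕ.+ 1) ℕ.* D
  eq₂ = solveℕ-∀

module _ (k : ℕ) .{{_ : NonZero k}} (c : ℕ) where

  φ-early : ∀ {l} → l ℕ.< loglog k → φ k l ≡ ⌈ k /2^ l ⌉
  φ-early {l} l<L with l ℕ.<ᵇ loglog k | ℕ.<⇒<ᵇ l<L
  ... | true | _ = refl

  φ-last : φ k (loglog k) ≡ k
  φ-last with loglog k ℕ.<ᵇ loglog k in eq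
  ... | true  = contradiction (ℕ.<ᵇ⇒< (loglog k) (loglog k) (subst T (sym eq) _)) (ℕ.<-irrefl refl)
  ... | false = refl

  phase : ℕ → List ℚ
  phase l = replicate (c ℕ.* φ k l) (phaseProb k l)

  phases : ℕ → List ℚ
  phases n = concatMap phase (upTo n)

  phases-suc : ∀ n → phases (suc n) ≡ phases n ++ phase n
  phases-suc n = begin
    concatMap phase (upTo (suc n))                  ≡⟨ cong (concatMap phase) (upTo-∷ʳ n) ⟨
    concatMap phase (upTo n ++ n ∷ [])              ≡⟨ concatMap-++ phase (upTo n) (n ∷ []) ⟩
    phases n ++ (phase n ++ [])                     ≡⟨ cong (phases n ++_) (++-identityʳ (phase n)) ⟩
    phases n ++ phase n                             ∎
    where open ≡-Reasoning

  length-phases-suc : ∀ n → length (phases (suc n)) ≡ length (phases n) ℕ.+ c ℕ.* φ k n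
  length-phases-suc n = begin
    length (phases (suc n))                   ≡⟨ cong length (phases-suc n) ⟩
    length (phases n ++ phase n)              ≡⟨ length-++ (phases n) ⟩
    length (phases n) ℕ.+ length (phase n)    ≡⟨ cong (length (phases n) ℕ.+_) (length-replicate _) ⟩
    length (phases n) ℕ.+ c ℕ.* φ k n         ∎
    where open ≡-Reasoning

  -- Telescoping: `2 * ⌈ k /2^ n ⌉` stands for the geometric tail still to come, and the summand `n`
  -- collects one unit of rounding per phase.
  length-phases : ∀ n → n ℕ.≤ loglog k →
                  length (phases n) ℕ.+ c ℕ.* (2 ℕ.* ⌈ k /2^ n ⌉) ℕ.≤ c ℕ.* (2 ℕ.* k ℕ.+ n)
  length-phases zero    _   = ℕ.≤-reflexive (cong (c ℕ.*_) (trans (cong (2 ℕ.*_) (trans (ℕ.n/1≡n _) (ℕ.+-identityʳ k))) (sym (ℕ.+-identityʳ _))))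
  length-phases (suc n) n<L = begin
    length (phases (suc n)) ℕ.+ c ℕ.* (2 ℕ.* a′)                  ≡⟨ cong (ℕ._+ c ℕ.* (2 ℕ.* a′)) (length-phases-suc n) ⟩
    length (phases n) ℕ.+ c ℕ.* φ k n ℕ.+ c ℕ.* (2 ℕ.* a′)        ≡⟨ cong (λ x → length (phases n) ℕ.+ c ℕ.* x ℕ.+ c ℕ.* (2 ℕ.* a′)) (φ-early n<L) ⟩
    length (phases n) ℕ.+ c ℕ.* a ℕ.+ c ℕ.* (2 ℕ.* a′)            ≤⟨ ℕ.+-monoʳ-≤ (length (phases n) ℕ.+ c ℕ.* a) (ℕ.*-monoʳ-≤ c (2⌈k/2^[1+l]⌉≤⌈k/2^l⌉+1 k n)) ⟩
    length (phases n) ℕ.+ c ℕ.* a ℕ.+ c ℕ.* (a ℕ.+ 1)             ≡⟨ eq₁ (length (phases n)) c a ⟩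
    length (phases n) ℕ.+ c ℕ.* (2 ℕ.* a) ℕ.+ c                   ≤⟨ ℕ.+-monoˡ-≤ c (length-phases n (ℕ.<⇒≤ n<L)) ⟩
    c ℕ.* (2 ℕ.* k ℕ.+ n) ℕ.+ c                                   ≡⟨ eq₂ c k n ⟩
    c ℕ.* (2 ℕ.* k ℕ.+ suc n)                                     ∎
    where
    open ℕ.≤-Reasoning
    a = ⌈ k /2^ n ⌉
    a′ = ⌈ k /2^ suc n ⌉
    eq₁ : ∀ x c a → x ℕ.+ c ℕ.* a ℕ.+ c ℕ.* (a ℕ.+ 1) ≡ x ℕ.+ c ℕ.* (2 ℕ.* a) ℕ.+ c
    eq₁ = solveℕ-∀
    eq₂ : ∀ c k n → c ℕ.* (2 ℕ.* k ℕ.+ n) ℕ.+ c ≡ c ℕ.* (2 ℕ.* k ℕ.+ (1 ℕ.+ n))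
    eq₂ = solveℕ-∀

  -- The 5 consists of 2 for the geometric sum, 2 for the rounding through the crude bound on
  -- `loglog k`, and 1 for the last phase.
  length-NonAdaptiveWithK : loglog k ℕ.≤ 2 ℕ.* k → length (NonAdaptiveWithK k c) ℕ.≤ 5 ℕ.* c ℕ.* k
  length-NonAdaptiveWithK L≤2k = begin
    length (phases (suc L))                       ≡⟨ length-phases-suc L ⟩
    length (phases L) ℕ.+ c ℕ.* φ k L             ≡⟨ cong (λ x → length (phases L) ℕ.+ c ℕ.* x) φ-last ⟩
    length (phases L) ℕ.+ c ℕ.* k                 ≤⟨ ℕ.+-monoˡ-≤ (c ℕ.* k) (ℕ.m+n≤o⇒m≤o (length (phases L)) (length-phases L ℕ.≤-refl)) ⟩
    c ℕ.* (2 ℕ.* k ℕ.+ L) ℕ.+ c ℕ.* k             ≤⟨ ℕ.+-monoˡ-≤ (c ℕ.* k) (ℕ.*-monoʳ-≤ c (ℕ.+-monoʳ-≤ (2 ℕ.* k) L≤2k)) ⟩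
    c ℕ.* (2 ℕ.* k ℕ.+ 2 ℕ.* k) ℕ.+ c ℕ.* k       ≡⟨ eq c k ⟩
    5 ℕ.* c ℕ.* k                                 ∎
    where
    open ℕ.≤-Reasoning
    L = loglog k
    eq : ∀ c k → c ℕ.* (2 ℕ.* k ℕ.+ 2 ℕ.* k) ℕ.+ c ℕ.* k ≡ 5 ℕ.* c ℕ.* k
    eq = solveℕ-∀

  0≤phaseProb : ∀ l → 0ℚ ≤ phaseProb k l
  0≤phaseProb l = 0≤/ (2 ℕ.^ l) (2 ℕ.* k) {{ℕ.m*n≢0 2 k}}

  phaseProb*2k : ∀ l → phaseProb k l * ⟦ 2 ℕ.* k ⟧ ≡ ⟦ 2 ℕ.^ l ⟧
  phaseProb*2k l = /-*-cancel (2 ℕ.^ l) (2 ℕ.* k) {{ℕ.m*n≢0 2 k}}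

  ¼phaseProb*8k : ∀ l → ¼ * phaseProb k l * ⟦ 8 ℕ.* k ⟧ ≡ ⟦ 2 ℕ.^ l ⟧
  ¼phaseProb*8k l = begin
    ¼ * phaseProb k l * ⟦ 8 ℕ.* k ⟧                    ≡⟨ cong (λ x → ¼ * phaseProb k l * ⟦ x ⟧) (ℕ.*-assoc 4 2 k) ⟩
    ¼ * phaseProb k l * ⟦ 4 ℕ.* (2 ℕ.* k) ⟧            ≡⟨ cong (¼ * phaseProb k l *_) (⟦⟧-* 4 (2 ℕ.* k)) ⟩
    ¼ * phaseProb k l * (⟦ 4 ⟧ * ⟦ 2 ℕ.* k ⟧)          ≡⟨ eq (phaseProb k l) ⟦ 2 ℕ.* k ⟧ ⟩
    phaseProb k l * ⟦ 2 ℕ.* k ⟧                        ≡⟨ phaseProb*2k l ⟩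
    ⟦ 2 ℕ.^ l ⟧                                        ∎
    where
    open ≡-Reasoning
    eq : ∀ p x → ¼ * p * (⟦ 4 ⟧ * x) ≡ p * x
    eq = solve-∀ ring

  1≤1+¼phaseProb : ∀ l → 1ℚ ≤ 1ℚ + ¼ * phaseProb k l
  1≤1+¼phaseProb l = ≤-by _ (*-nonNeg 0≤¼ (0≤phaseProb l)) refl

  growth-phase : ∀ l → growth (phase l) (c ℕ.* φ k l) ≡ (1ℚ + ¼ * phaseProb k l) ^ℚ (c ℕ.* φ k l)
  growth-phase l = growth-replicate {c ℕ.* φ k l} (phaseProb k l) ℕ.≤-refl

  growth-phases-suc : ∀ n → growth (phases (suc n)) (length (phases (suc n))) ≡
    growth (phases n) (length (phases n)) * (1ℚ + ¼ * phaseProb k n) ^ℚ (c ℕ.* φ k n)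
  growth-phases-suc n = begin
    growth (phases (suc n)) (length (phases (suc n)))                     ≡⟨ cong₂ growth (phases-suc n) (length-phases-suc n) ⟩
    growth (phases n ++ phase n) (length (phases n) ℕ.+ c ℕ.* φ k n)      ≡⟨ growth-++ʳ (phases n) (phase n) _ ⟩
    growth (phases n) (length (phases n)) * growth (phase n) (c ℕ.* φ k n) ≡⟨ cong (growth (phases n) (length (phases n)) *_) (growth-phase n) ⟩
    growth (phases n) (length (phases n)) * (1ℚ + ¼ * phaseProb k n) ^ℚ (c ℕ.* φ k n) ∎
    where open ≡-Reasoning

  module _ {M : ℕ} (8M≤c : 8 ℕ.* M ℕ.≤ c) where

    -- In every early phase the transmission probabilities of a station sum to at least `c / 2`. A
    -- quarter of that is at least `M`, and Bernoulli's inequality suffices.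
    phase-factor : ∀ {l} → l ℕ.< loglog k → ⟦ M ⟧ ≤ (1ℚ + ¼ * phaseProb k l) ^ℚ (c ℕ.* φ k l)
    phase-factor {l} l<L = begin
      ⟦ M ⟧                                                 ≤⟨ *⟦⟧-cancel-≤ (8 ℕ.* k) {{ℕ.m*n≢0 8 k}} M*8k≤ ⟩
      ⟦ c ℕ.* φ k l ⟧ * (¼ * phaseProb k l)                 ≤⟨ ≤-by 1ℚ 0≤1 (+-comm 1ℚ (⟦ c ℕ.* φ k l ⟧ * (¼ * phaseProb k l))) ⟩
      1ℚ + ⟦ c ℕ.* φ k l ⟧ * (¼ * phaseProb k l)            ≤⟨ bernoulli (c ℕ.* φ k l) (*-nonNeg 0≤¼ (0≤phaseProb l)) ⟩
      (1ℚ + ¼ * phaseProb k l) ^ℚ (c ℕ.* φ k l)             ∎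
      where
      open ≤-Reasoning
      M*8k≤ : ⟦ M ⟧ * ⟦ 8 ℕ.* k ⟧ ≤ ⟦ c ℕ.* φ k l ⟧ * (¼ * phaseProb k l) * ⟦ 8 ℕ.* k ⟧
      M*8k≤ = begin
        ⟦ M ⟧ * ⟦ 8 ℕ.* k ⟧                        ≡⟨ ⟦⟧-* M (8 ℕ.* k) ⟨
        ⟦ M ℕ.* (8 ℕ.* k) ⟧                        ≤⟨ ⟦⟧-mono-≤ M*8k≤cφ2^l ⟩
        ⟦ c ℕ.* φ k l ℕ.* 2 ℕ.^ l ⟧                ≡⟨ ⟦⟧-* (c ℕ.* φ k l) (2 ℕ.^ l) ⟩
        ⟦ c ℕ.* φ k l ⟧ * ⟦ 2 ℕ.^ l ⟧              ≡⟨ cong (⟦ c ℕ.* φ k l ⟧ *_) (¼phaseProb*8k l) ⟨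
        ⟦ c ℕ.* φ k l ⟧ * (¼ * phaseProb k l * ⟦ 8 ℕ.* k ⟧)  ≡⟨ *-assoc ⟦ c ℕ.* φ k l ⟧ (¼ * phaseProb k l) ⟦ 8 ℕ.* k ⟧ ⟨
        ⟦ c ℕ.* φ k l ⟧ * (¼ * phaseProb k l) * ⟦ 8 ℕ.* k ⟧  ∎
        where
        M*8k≤cφ2^l : M ℕ.* (8 ℕ.* k) ℕ.≤ c ℕ.* φ k l ℕ.* 2 ℕ.^ l
        M*8k≤cφ2^l rewrite φ-early l<L = ℕ.≤-trans (ℕ.≤-reflexive (eq M k)) (ℕ.≤-trans
          (ℕ.*-mono-≤ 8M≤c (k≤⌈k/2^l⌉*2^l k l)) (ℕ.≤-reflexive (sym (ℕ.*-assoc c ⌈ k /2^ l ⌉ (2 ℕ.^ l)))))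
          where
          eq : ∀ M k → M ℕ.* (8 ℕ.* k) ≡ 8 ℕ.* M ℕ.* k
          eq = solveℕ-∀

    M^n≤growth-phases : ∀ n → n ℕ.≤ loglog k → ⟦ M ⟧ ^ℚ n ≤ growth (phases n) (length (phases n))
    M^n≤growth-phases zero    _   = ≤-refl
    M^n≤growth-phases (suc n) n<L = begin
      ⟦ M ⟧ * ⟦ M ⟧ ^ℚ n  ≡⟨ *-comm ⟦ M ⟧ (⟦ M ⟧ ^ℚ n) ⟩
      ⟦ M ⟧ ^ℚ n * ⟦ M ⟧  ≤⟨ *-mono-≤ (^-nonNeg n 0≤⟦ M ⟧) 0≤⟦ M ⟧ (M^n≤growth-phases n (ℕ.<⇒≤ n<L)) (phase-factor n<L) ⟩
      growth (phases n) (length (phases n)) * (1ℚ + ¼ * phaseProb k n) ^ℚ (c ℕ.* φ k n)  ≡⟨ growth-phases-suc n ⟨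
      growth (phases (suc n)) (length (phases (suc n)))  ∎
      where open ≤-Reasoning

    -- The bound on the growth counts the `l` completed phases only, not the progress within phase
    -- `l`.
    InPhase : ℕ → ℕ → Set
    InPhase n a = ∃[ l ] l ℕ.< n × prob (phases n) a ≡ phaseProb k l × ⟦ M ⟧ ^ℚ l ≤ growth (phases n) a

    earlier-phase : ∀ n a → a ℕ.< length (phases n) → InPhase n a → InPhase (suc n) a
    earlier-phase n a a<len (l , l<n , p≡ , M^l≤) =
      l , ℕ.m<n⇒m<1+n l<n ,
      trans (cong (λ ps → prob ps a) (phases-suc n)) (trans (prob-++ˡ (phases n) (phase n) a<len) p≡) ,
      ≤-trans M^l≤ (≤-reflexive (sym (trans (cong (λ ps → growth ps a) (phases-suc n))
                                            (growth-++ˡ (phases n) (phase n) (ℕ.<⇒≤ a<len)))))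

    current-phase : ∀ n → n ℕ.≤ loglog k → ∀ b → length (phases n) ℕ.+ b ℕ.< length (phases (suc n)) →
                 InPhase (suc n) (length (phases n) ℕ.+ b)
    current-phase n n≤L b a<len = n , ℕ.n<1+n n , p≡ , M^n≤
      where
      b<cφ : b ℕ.< c ℕ.* φ k n
      b<cφ = ℕ.+-cancelˡ-< (length (phases n)) b _ (subst (length (phases n) ℕ.+ b ℕ.<_) (length-phases-suc n) a<len)
      p≡ : prob (phases (suc n)) (length (phases n) ℕ.+ b) ≡ phaseProb k n
      p≡ = trans (cong (λ ps → prob ps (length (phases n) ℕ.+ b)) (phases-suc n))
          (trans (prob-++ʳ (phases n) (phase n) b) (prob-replicate (phaseProb k n) b<cφ))
      M^n≤ : ⟦ M ⟧ ^ℚ n ≤ growth (phases (suc n)) (length (phases n) ℕ.+ b)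
      M^n≤ = begin
        ⟦ M ⟧ ^ℚ n                                                            ≡⟨ *-identityʳ (⟦ M ⟧ ^ℚ n) ⟨
        ⟦ M ⟧ ^ℚ n * 1ℚ                                                       ≤⟨ *-mono-≤ (^-nonNeg n 0≤⟦ M ⟧) 0≤1 (M^n≤growth-phases n n≤L) (1≤^ b (1≤1+¼phaseProb n)) ⟩
        growth (phases n) (length (phases n)) * (1ℚ + ¼ * phaseProb k n) ^ℚ b ≡⟨ cong (growth (phases n) (length (phases n)) *_) (growth-replicate (phaseProb k n) (ℕ.<⇒≤ b<cφ)) ⟨
        growth (phases n) (length (phases n)) * growth (phase n) b            ≡⟨ growth-++ʳ (phases n) (phase n) b ⟨
        growth (phases n ++ phase n) (length (phases n) ℕ.+ b)                ≡⟨ cong (λ ps → growth ps (length (phases n) ℕ.+ b)) (phases-suc n) ⟨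
        growth (phases (suc n)) (length (phases n) ℕ.+ b)                     ∎
        where open ≤-Reasoning

    prob-phases : ∀ n → n ℕ.≤ suc (loglog k) → ∀ a → a ℕ.< length (phases n) → InPhase n a
    prob-phases (suc n) (s≤s n≤L) a a<len = [_,_]′
      (λ a<len′ → earlier-phase n a a<len′ (prob-phases n (ℕ.m≤n⇒m≤1+n n≤L) a a<len′))
      (λ len≤a → subst (InPhase (suc n)) (ℕ.m+[n∸m]≡n len≤a)
        (current-phase n n≤L (a ℕ.∸ length (phases n))
          (subst (ℕ._< length (phases (suc n))) (sym (ℕ.m+[n∸m]≡n len≤a)) a<len)))
      (ℕ.<-≤-connex a (length (phases n)))

-- Overload of the channel

∏-replicate : ∀ n x → ∏ {n} (λ _ → x) ≡ x ^ℚ n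
∏-replicate zero    x = refl
∏-replicate (suc n) x = cong (x *_) (∏-replicate n x)

∑-*⟦⟧ : ∀ {n N} {p : Fin n → ℚ} {u : Fin n → ℕ} → (∀ i → p i * N ≡ ⟦ u i ⟧) → ∑ p * N ≡ ⟦ ∑ℕ u ⟧
∑-*⟦⟧ {zero}  {N} pN≡u = *-zeroˡ N
∑-*⟦⟧ {suc n} {N} {p} {u} pN≡u = begin
  (p zero + ∑ (p ∘ suc)) * N           ≡⟨ *-distribʳ-+ N (p zero) (∑ (p ∘ suc)) ⟩
  p zero * N + ∑ (p ∘ suc) * N         ≡⟨ cong₂ _+_ (pN≡u zero) (∑-*⟦⟧ (pN≡u ∘ suc)) ⟩
  ⟦ u zero ⟧ + ⟦ ∑ℕ (u ∘ suc) ⟧        ≡⟨ ⟦⟧-+ (u zero) (∑ℕ (u ∘ suc)) ⟨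
  ⟦ ∑ℕ u ⟧                             ∎
  where open ≡-Reasoning

-- The spare factor `x` forgives one unit of load per station. This pays for stations in phase 0,
-- whose load is 1 and whose weight may be close to 1.
^∑ℕ≤∏*^ : ∀ {n x} {w : Fin n → ℚ} {u : Fin n → ℕ} → 0ℚ ≤ x → (∀ i → x ^ℚ u i ≤ w i * x) →
          x ^ℚ ∑ℕ u ≤ ∏ w * x ^ℚ n
^∑ℕ≤∏*^ {zero}  0≤x x^u≤wx = ≤-refl
^∑ℕ≤∏*^ {suc n} {x} {w} {u} 0≤x x^u≤wx = begin
  x ^ℚ (u zero ℕ.+ ∑ℕ (u ∘ suc))                ≡⟨ ^-homo-* x (u zero) (∑ℕ (u ∘ suc)) ⟩
  x ^ℚ u zero * x ^ℚ ∑ℕ (u ∘ suc)               ≤⟨ *-mono-≤ (^-nonNeg (u zero) 0≤x) (^-nonNeg (∑ℕ (u ∘ suc)) 0≤x)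
                                                     (x^u≤wx zero) (^∑ℕ≤∏*^ 0≤x (x^u≤wx ∘ suc)) ⟩
  w zero * x * (∏ (w ∘ suc) * x ^ℚ n)           ≡⟨ eq (w zero) x (∏ (w ∘ suc)) (x ^ℚ n) ⟩
  w zero * ∏ (w ∘ suc) * (x * x ^ℚ n)           ∎
  where
  open ≤-Reasoning
  eq : ∀ a x b y → a * x * (b * y) ≡ a * b * (x * y)
  eq = solve-∀ ring

inverse^ : ∀ {x y} n → x * y ≡ 1ℚ → x ^ℚ n * y ^ℚ n ≡ 1ℚ
inverse^ {x} {y} n xy≡1 = trans (sym (^-distrib-* x y n)) (trans (cong (_^ℚ n) xy≡1) (1^n≡1 n))

^-swap : ∀ x m n → (x ^ℚ m) ^ℚ n ≡ (x ^ℚ n) ^ℚ m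
^-swap x m n = trans (^-assocʳ x m n) (trans (cong (x ^ℚ_) (ℕ.*-comm m n)) (sym (^-assocʳ x n m)))

-- Here u i / 2k is the transmission probability of station i.
overload : ∀ {k} .{{_ : NonZero k}} {p w : Fin k → ℚ} {u : Fin k → ℕ} {r R} →
  0ℚ ≤ r → 1ℚ ≤ R → r * R ≡ 1ℚ →
  (∀ i → p i * ⟦ 2 ℕ.* k ⟧ ≡ ⟦ u i ⟧) → (∀ i → (R ^ℚ 2) ^ℚ u i ≤ w i * R ^ℚ 2) →
  ¬ (∑ p ≤ 1ℚ - ¼) → 1ℚ ≤ r ^ℚ k * ∏ w
overload {k} {p} {w} {u} {r} {R} 0≤r 1≤R rR≡1 2kp≡u R^u≤wR heavy = begin
  1ℚ                                              ≡⟨ cong₂ _*_ xX≡1 (cong₂ _*_ xX≡1 xX≡1) ⟨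
  x * X * (x * X * (x * X))                       ≡⟨ eq₁ x X ⟩
  x * x * x * (X * (X * X))                       ≤⟨ *-monoˡ-≤ (x * x * x) (*-nonNeg (*-nonNeg 0≤x 0≤x) 0≤x) X³≤ ⟩
  x * x * x * (∏ w * (X * X))                     ≡⟨ eq₂ x X (∏ w) ⟩
  x * ∏ w * (x * X * (x * X))                     ≡⟨ cong (x * ∏ w *_) (cong₂ _*_ xX≡1 xX≡1) ⟩
  x * ∏ w * 1ℚ                                    ≡⟨ *-identityʳ (x * ∏ w) ⟩
  x * ∏ w                                         ∎
  where
  open ≤-Reasoning
  x = r ^ℚ k
  X = R ^ℚ k
  xX≡1 = inverse^ k rR≡1
  0≤x : 0ℚ ≤ x
  0≤x = ^-nonNeg k 0≤r
  eq₁ : ∀ x X → x * X * (x * X * (x * X)) ≡ x * x * x * (X * (X * X))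
  eq₁ = solve-∀ ring
  eq₂ : ∀ x X W → x * x * x * (W * (X * X)) ≡ x * W * (x * X * (x * X))
  eq₂ = solve-∀ ring
  eq₃ : ∀ n → (1ℚ - ¼) * (⟦ 2 ⟧ * (⟦ 2 ⟧ * n)) ≡ ⟦ 3 ⟧ * n
  eq₃ = solve-∀ ring
  -- An overload means that the loads `u i` sum to at least 3k/2, so `R ^ℚ 2` raised to the total
  -- load is at least `R ^ℚ (3 ℕ.* k)`. The forgiven units account for the power 2k, which leaves
  -- `R ^ℚ k` for `∏ w`.
  3k≤2∑u : 3 ℕ.* k ℕ.≤ 2 ℕ.* ∑ℕ u
  3k≤2∑u = ℕ.≮⇒≥ λ 2∑u<3k → heavy (*⟦⟧-cancel-≤ (2 ℕ.* (2 ℕ.* k)) {{ℕ.m*n≢0 2 (2 ℕ.* k) {{_}} {{ℕ.m*n≢0 2 k}}}} (begin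
    ∑ p * ⟦ 2 ℕ.* (2 ℕ.* k) ⟧           ≡⟨ cong (∑ p *_) (⟦⟧-* 2 (2 ℕ.* k)) ⟩
    ∑ p * (⟦ 2 ⟧ * ⟦ 2 ℕ.* k ⟧)         ≡⟨ eq₄ (∑ p) ⟦ 2 ℕ.* k ⟧ ⟩
    ⟦ 2 ⟧ * (∑ p * ⟦ 2 ℕ.* k ⟧)         ≡⟨ cong (⟦ 2 ⟧ *_) (∑-*⟦⟧ 2kp≡u) ⟩
    ⟦ 2 ⟧ * ⟦ ∑ℕ u ⟧                    ≡⟨ ⟦⟧-* 2 (∑ℕ u) ⟨
    ⟦ 2 ℕ.* ∑ℕ u ⟧                      ≤⟨ ⟦⟧-mono-≤ (ℕ.<⇒≤ 2∑u<3k) ⟩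
    ⟦ 3 ℕ.* k ⟧                         ≡⟨ ⟦⟧-* 3 k ⟩
    ⟦ 3 ⟧ * ⟦ k ⟧                       ≡⟨ eq₃ ⟦ k ⟧ ⟨
    (1ℚ - ¼) * (⟦ 2 ⟧ * (⟦ 2 ⟧ * ⟦ k ⟧)) ≡⟨ cong (λ y → (1ℚ - ¼) * (⟦ 2 ⟧ * y)) (⟦⟧-* 2 k) ⟨
    (1ℚ - ¼) * (⟦ 2 ⟧ * ⟦ 2 ℕ.* k ⟧)    ≡⟨ cong ((1ℚ - ¼) *_) (⟦⟧-* 2 (2 ℕ.* k)) ⟨
    (1ℚ - ¼) * ⟦ 2 ℕ.* (2 ℕ.* k) ⟧      ∎))
    where
    eq₄ : ∀ s n → s * (⟦ 2 ⟧ * n) ≡ ⟦ 2 ⟧ * (s * n)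
    eq₄ = solve-∀ ring
  X³≡ : X * (X * X) ≡ R ^ℚ (3 ℕ.* k)
  X³≡ = trans (eq₅ X) (trans (^-assocʳ R k 3) (cong (R ^ℚ_) (ℕ.*-comm k 3)))
    where
    eq₅ : ∀ X → X * (X * X) ≡ X * (X * (X * 1ℚ))
    eq₅ = solve-∀ ring
  X²≡ : (R ^ℚ 2) ^ℚ k ≡ X * X
  X²≡ = trans (^-swap R 2 k) (cong (X *_) (*-identityʳ X))
  X³≤ : X * (X * X) ≤ ∏ w * (X * X)
  X³≤ = begin
    X * (X * X)                ≡⟨ X³≡ ⟩
    R ^ℚ (3 ℕ.* k)             ≤⟨ ^-monoʳ-≤ 1≤R 3k≤2∑u ⟩
    R ^ℚ (2 ℕ.* ∑ℕ u)          ≡⟨ ^-assocʳ R 2 (∑ℕ u) ⟨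
    (R ^ℚ 2) ^ℚ ∑ℕ u           ≤⟨ ^∑ℕ≤∏*^ (^-nonNeg 2 (≤-trans 0≤1 1≤R)) R^u≤wR ⟩
    ∏ w * (R ^ℚ 2) ^ℚ k        ≡⟨ cong (∏ w *_) X²≡ ⟩
    ∏ w * (X * X)              ∎

-- Logarithms compared with the number of stations

⌈log₂⌉-nonZero : ∀ {k} → 2 ℕ.≤ k → NonZero ⌈log₂ k ⌉
⌈log₂⌉-nonZero 2≤k = ℕ.>-nonZero (⌈log₂⌉-mono-≤ 2≤k)

module _ {k : ℕ} (2≤k : 2 ℕ.≤ k) where

  private
    n D : ℕ
    n = ⌈log₂ k ⌉
    D = 2 ℕ.^ loglog k
    instance
      n≢0 = ⌈log₂⌉-nonZero 2≤k
      k≢0 = ℕ.>-nonZero (ℕ.<⇒≤ 2≤k)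

  -- `D` is at most `2 ℕ.* n`, so the left side is of order log² k.
  2^loglog*log≤8k : D ℕ.* n ℕ.≤ 8 ℕ.* k
  2^loglog*log≤8k = begin
    D ℕ.* n                      ≤⟨ ℕ.*-monoˡ-≤ n (2^⌈log₂n⌉≤2n n) ⟩
    2 ℕ.* n ℕ.* n                ≡⟨ ℕ.*-assoc 2 n n ⟩
    2 ℕ.* (n ℕ.* n)              ≤⟨ ℕ.*-monoʳ-≤ 2 (n²≤2*2^n n) ⟩
    2 ℕ.* (2 ℕ.* 2 ℕ.^ n)        ≤⟨ ℕ.*-monoʳ-≤ 2 (ℕ.*-monoʳ-≤ 2 (2^⌈log₂n⌉≤2n k)) ⟩
    2 ℕ.* (2 ℕ.* (2 ℕ.* k))      ≡⟨ eq k ⟩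
    8 ℕ.* k                      ∎
    where
    open ℕ.≤-Reasoning
    eq : ∀ k → 2 ℕ.* (2 ℕ.* (2 ℕ.* k)) ≡ 8 ℕ.* k
    eq = solveℕ-∀

  2log≤2k : 2 ℕ.* n ℕ.≤ 2 ℕ.* k
  2log≤2k = ℕ.≤-trans (2n≤2^n n) (2^⌈log₂n⌉≤2n k)

  2^loglog≤2k : D ℕ.≤ 2 ℕ.* k
  2^loglog≤2k = ℕ.≤-trans (2^⌈log₂n⌉≤2n n) 2log≤2k

  loglog≤2k : loglog k ℕ.≤ 2 ℕ.* k
  loglog≤2k = ℕ.≤-trans (ℕ.<⇒≤ (n<2^n (loglog k))) 2^loglog≤2k

  -- Every block of `2 ℕ.* D` factors has product at least 2, and `n` such blocks fit into
  -- `16 ℕ.* k` factors.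
  k≤[1+ψ]^16k : ∀ {ψ} → 0ℚ ≤ ψ → ψ * ⟦ 2 ℕ.* D ⟧ ≡ 1ℚ → ⟦ k ⟧ ≤ (1ℚ + ψ) ^ℚ (16 ℕ.* k)
  k≤[1+ψ]^16k {ψ} 0≤ψ 2Dψ≡1 = begin
    ⟦ k ⟧                                   ≤⟨ ⟦⟧-mono-≤ (n≤2^⌈log₂n⌉ k) ⟩
    ⟦ 2 ℕ.^ n ⟧                             ≡⟨ ⟦⟧-^ 2 n ⟩
    ⟦ 2 ⟧ ^ℚ n                              ≤⟨ ^-monoˡ-≤ n 0≤⟦ 2 ⟧ (2≤[1+x]^n (2 ℕ.* D) 0≤ψ (≤-reflexive (trans (sym 2Dψ≡1) (*-comm ψ _)))) ⟩
    ((1ℚ + ψ) ^ℚ (2 ℕ.* D)) ^ℚ n            ≡⟨ ^-assocʳ (1ℚ + ψ) (2 ℕ.* D) n ⟩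
    (1ℚ + ψ) ^ℚ (2 ℕ.* D ℕ.* n)             ≤⟨ ^-monoʳ-≤ (≤-by ψ 0≤ψ refl) 2Dn≤16k ⟩
    (1ℚ + ψ) ^ℚ (16 ℕ.* k)                  ∎
    where
    open ≤-Reasoning
    2Dn≤16k : 2 ℕ.* D ℕ.* n ℕ.≤ 16 ℕ.* k
    2Dn≤16k = ℕ.≤-trans (ℕ.≤-reflexive (ℕ.*-assoc 2 D n)) (ℕ.≤-trans (ℕ.*-monoʳ-≤ 2 2^loglog*log≤8k) (ℕ.≤-reflexive (sym (ℕ.*-assoc 2 8 k))))

  -- Here `y` is a quarter of the transmission probability of the last phase. Since `n ≤ D`, a block
  -- of `j > 8k / n` factors has product at least 2, and `n` blocks take at most `8k + n` factors.
  k≤[1+y]^16k : ∀ {y} → 0ℚ ≤ y → y * ⟦ 8 ℕ.* k ⟧ ≡ ⟦ D ⟧ → ⟦ k ⟧ ≤ (1ℚ + y) ^ℚ (16 ℕ.* k)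
  k≤[1+y]^16k {y} 0≤y 8ky≡D = begin
    ⟦ k ⟧                        ≤⟨ ⟦⟧-mono-≤ (n≤2^⌈log₂n⌉ k) ⟩
    ⟦ 2 ℕ.^ n ⟧                  ≡⟨ ⟦⟧-^ 2 n ⟩
    ⟦ 2 ⟧ ^ℚ n                   ≤⟨ ^-monoˡ-≤ n 0≤⟦ 2 ⟧ (2≤[1+x]^n j 0≤y 1≤jy) ⟩
    ((1ℚ + y) ^ℚ j) ^ℚ n         ≡⟨ ^-assocʳ (1ℚ + y) j n ⟩
    (1ℚ + y) ^ℚ (j ℕ.* n)        ≤⟨ ^-monoʳ-≤ (≤-by y 0≤y refl) jn≤16k ⟩
    (1ℚ + y) ^ℚ (16 ℕ.* k)       ∎
    where
    open ≤-Reasoning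
    j = suc (8 ℕ.* k ℕ./ n)
    jn≤16k : j ℕ.* n ℕ.≤ 16 ℕ.* k
    jn≤16k = ℕ.≤-trans (ℕ.+-mono-≤ (ℕ.≤-trans (ℕ.m≤m+n n (n ℕ.+ 0)) 2log≤2k) (ℕ.m/n*n≤m (8 ℕ.* k) n))
      (ℕ.≤-trans (ℕ.m≤m+n (2 ℕ.* k ℕ.+ 8 ℕ.* k) (6 ℕ.* k)) (ℕ.≤-reflexive (eq k)))
      where
      eq : ∀ k → 2 ℕ.* k ℕ.+ 8 ℕ.* k ℕ.+ 6 ℕ.* k ≡ 16 ℕ.* k
      eq = solveℕ-∀
    8k≤jn : 8 ℕ.* k ℕ.≤ j ℕ.* n
    8k≤jn = ℕ.≤-trans (ℕ.≤-reflexive (ℕ.m≡m%n+[m/n]*n (8 ℕ.* k) n))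
      (ℕ.+-monoˡ-≤ (8 ℕ.* k ℕ./ n ℕ.* n) (ℕ.<⇒≤ (ℕ.m%n<n (8 ℕ.* k) n)))
    1≤jy : 1ℚ ≤ ⟦ j ⟧ * y
    1≤jy = *⟦⟧-cancel-≤ (8 ℕ.* k) {{ℕ.m*n≢0 8 k}} (begin
      1ℚ * ⟦ 8 ℕ.* k ⟧           ≡⟨ *-identityˡ ⟦ 8 ℕ.* k ⟧ ⟩
      ⟦ 8 ℕ.* k ⟧                ≤⟨ ⟦⟧-mono-≤ (ℕ.≤-trans 8k≤jn (ℕ.*-monoʳ-≤ j (n≤2^⌈log₂n⌉ n))) ⟩
      ⟦ j ℕ.* D ⟧                ≡⟨ ⟦⟧-* j D ⟩
      ⟦ j ⟧ * ⟦ D ⟧              ≡⟨ cong (⟦ j ⟧ *_) 8ky≡D ⟨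
      ⟦ j ⟧ * (y * ⟦ 8 ℕ.* k ⟧)  ≡⟨ *-assoc ⟦ j ⟧ y ⟦ 8 ℕ.* k ⟧ ⟨
      ⟦ j ⟧ * y * ⟦ 8 ℕ.* k ⟧    ∎)

-- Lower bound for the weight of a station in phase l > 0 with transmission probability 2^l / 2k.
phase-weight : ∀ {D ψ} m l → 0ℚ ≤ ψ → ψ * ⟦ 2 ℕ.* D ⟧ ≡ 1ℚ → 2 ℕ.^ suc l ℕ.≤ D →
  ((1ℚ + ψ) ^ℚ m) ^ℚ (2 ℕ.^ suc l) ≤ 1ℚ + ψ * ⟦ 4 ℕ.* 3 ℕ.^ m ⟧ ^ℚ suc l
phase-weight {D} {ψ} m l 0≤ψ 2Dψ≡1 2^l≤D = begin
  ((1ℚ + ψ) ^ℚ m) ^ℚ N                 ≡⟨ ^-swap (1ℚ + ψ) m N ⟩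
  -- Taking the power `N` first leaves a base of at most 2, because `2 ℕ.* N` is at most `2 ℕ.* D`;
  -- the power `m` then costs only the factor 3 to the `m`.
  ((1ℚ + ψ) ^ℚ N) ^ℚ m                 ≤⟨ ^-monoˡ-≤ m (^-nonNeg N (+-nonNeg 0≤1 0≤ψ)) ([1+x]^n≤1+2nx N 0≤ψ y≤1) ⟩
  (1ℚ + y) ^ℚ m                        ≤⟨ [1+y]^n≤1+3^ny m 0≤y y≤1 ⟩
  1ℚ + ⟦ 3 ⟧ ^ℚ m * y                  ≤⟨ +-monoʳ-≤ 1ℚ bound ⟩
  1ℚ + ψ * ⟦ M ⟧ ^ℚ suc l              ∎
  where
  open ≤-Reasoning
  N = 2 ℕ.^ suc l
  M = 4 ℕ.* 3 ℕ.^ m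
  y = ⟦ 2 ⟧ * ⟦ N ⟧ * ψ
  0≤y : 0ℚ ≤ y
  0≤y = *-nonNeg (*-nonNeg 0≤⟦ 2 ⟧ 0≤⟦ N ⟧) 0≤ψ
  y≤1 : y ≤ 1ℚ
  y≤1 = begin
    ⟦ 2 ⟧ * ⟦ N ⟧ * ψ    ≡⟨ cong (_* ψ) (⟦⟧-* 2 N) ⟨
    ⟦ 2 ℕ.* N ⟧ * ψ      ≤⟨ *-monoʳ-≤ ψ 0≤ψ (⟦⟧-mono-≤ (ℕ.*-monoʳ-≤ 2 2^l≤D)) ⟩
    ⟦ 2 ℕ.* D ⟧ * ψ      ≡⟨ *-comm ⟦ 2 ℕ.* D ⟧ ψ ⟩
    ψ * ⟦ 2 ℕ.* D ⟧      ≡⟨ 2Dψ≡1 ⟩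
    1ℚ                   ∎
  -- As `2 ℕ.* N` is 4 times `2 ℕ.^ l`, the factor 4 in `M` makes the left side equal to
  -- `M ℕ.* 2 ℕ.^ l`, and `2 ≤ M`.
  3^m*2N≤M^[1+l] : 3 ℕ.^ m ℕ.* (2 ℕ.* N) ℕ.≤ M ℕ.^ suc l
  3^m*2N≤M^[1+l] = ℕ.≤-trans (ℕ.≤-reflexive (eq (3 ℕ.^ m) (2 ℕ.^ l)))
    (ℕ.*-monoʳ-≤ M (ℕ.^-monoˡ-≤ l (ℕ.≤-trans (ℕ.m≤m*n 2 2) (ℕ.m≤m*n 4 (3 ℕ.^ m) {{ℕ.m^n≢0 3 m}}))))
    where
    eq : ∀ t x → t ℕ.* (2 ℕ.* (2 ℕ.* x)) ≡ 4 ℕ.* t ℕ.* x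
    eq = solveℕ-∀
  bound : ⟦ 3 ⟧ ^ℚ m * y ≤ ψ * ⟦ M ⟧ ^ℚ suc l
  bound = begin
    ⟦ 3 ⟧ ^ℚ m * (⟦ 2 ⟧ * ⟦ N ⟧ * ψ)        ≡⟨ eq (⟦ 3 ⟧ ^ℚ m) (⟦ 2 ⟧ * ⟦ N ⟧) ψ ⟩
    ψ * (⟦ 3 ⟧ ^ℚ m * (⟦ 2 ⟧ * ⟦ N ⟧))      ≡⟨ cong (ψ *_) (cong₂ _*_ (⟦⟧-^ 3 m) (⟦⟧-* 2 N)) ⟨
    ψ * (⟦ 3 ℕ.^ m ⟧ * ⟦ 2 ℕ.* N ⟧)         ≡⟨ cong (ψ *_) (⟦⟧-* (3 ℕ.^ m) (2 ℕ.* N)) ⟨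
    ψ * ⟦ 3 ℕ.^ m ℕ.* (2 ℕ.* N) ⟧           ≤⟨ *-monoˡ-≤ ψ 0≤ψ (⟦⟧-mono-≤ 3^m*2N≤M^[1+l]) ⟩
    ψ * ⟦ M ℕ.^ suc l ⟧                     ≡⟨ cong (ψ *_) (⟦⟧-^ M (suc l)) ⟩
    ψ * ⟦ M ⟧ ^ℚ suc l                      ∎
    where
    eq : ∀ a b ψ → a * (b * ψ) ≡ ψ * (a * b)
    eq = solve-∀ ring

-- Natural bounds for a real exponent

⟦⟧-cancel-≤ : ∀ {m n} → ⟦ m ⟧ ≤ ⟦ n ⟧ → m ℕ.≤ n
⟦⟧-cancel-≤ {m} {n} ⟦m⟧≤⟦n⟧ = ℕ.≮⇒≥ λ n<m → contradiction
  (+-monoˡ-≤ (- ⟦ n ⟧) (≤-trans (≤-reflexive (sym (⟦⟧-+ 1 n))) (≤-trans (⟦⟧-mono-≤ n<m) ⟦m⟧≤⟦n⟧)))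
  (<⇒≱ (subst₂ _<_ (sym (+-inverseʳ ⟦ n ⟧)) (eq ⟦ n ⟧) (positive⁻¹ 1ℚ)))
  where
  eq : ∀ x → 1ℚ ≡ 1ℚ + x - x
  eq = solve-∀ ring
  <⇒≱ : ∀ {p q} → p < q → ¬ (q ≤ p)
  <⇒≱ p<q q≤p = <-irrefl refl (<-≤-trans p<q q≤p)

archimedean : ∀ r → ∃[ n ] r ≤ ⟦ n ⟧
archimedean r@(mkℚ i d _) = ℤ.∣ i ∣ , toℚᵘ-cancel-≤ (ℚᵘ.≤-respʳ-≃ (ℚᵘ.≃-sym (toℚᵘ-/ (+ ℤ.∣ i ∣) 1)) (ℚᵘ.*≤* (≤∣i∣*d i)))
  where
  ≤∣i∣*d : ∀ i → i ℤ.* + 1 ℤ.≤ + ℤ.∣ i ∣ ℤ.* + suc d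
  ≤∣i∣*d (+ n)        = ℤ.*-monoˡ-≤-nonNeg (+ n) (ℤ.+≤+ (s≤s z≤n))
  ≤∣i∣*d ℤ.-[1+ n ]   = ℤ.-≤+

-- Every element of the upper cut bounds the lower cut, so a natural number above one such element
-- can replace the real exponent.
upper-bound : (η : ℝ) → ∃[ e ] (∀ p q .{{_ : NonZero q}} → lower η (+ p / q) → p ℕ.≤ e ℕ.* q)
upper-bound η with upper-inhabited η
... | r , η<r with archimedean r
...   | e , r≤e = e , λ p q p/q<η → ⟦⟧-cancel-≤ (begin
  ⟦ p ⟧               ≡⟨ /-*-cancel p q ⟨
  (+ p / q) * ⟦ q ⟧   ≤⟨ *-monoʳ-≤ ⟦ q ⟧ 0≤⟦ q ⟧ (≤-trans (p≤r (+ p / q) p/q<η) r≤e) ⟩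
  ⟦ e ⟧ * ⟦ q ⟧       ≡⟨ ⟦⟧-* e q ⟨
  ⟦ e ℕ.* q ⟧         ∎)
  where
  open ≤-Reasoning
  p≤r : ∀ p → lower η p → p ≤ r
  p≤r p p<η with p ≤? r
  ... | yes p≤r = p≤r
  ... | no  p≰r = contradiction (Equivalence.from (lower-rounded η r) (p , ≰⇒> p≰r , p<η) , η<r) (disjoint η r)

-- The `q`-th power of the bound with exponent `e` implies the one with exponent `p / q`, because
-- `p ≤ e ℕ.* q` and `1 ≤ k`.
≤1/^-from-ℕ : ∀ {x k} .{{_ : NonZero k}} {η : ℝ} {e} → (∀ p q .{{_ : NonZero q}} → lower η (+ p / q) → p ℕ.≤ e ℕ.* q) →
  0ℚ ≤ x → x * ⟦ k ⟧ ^ℚ e ≤ 1ℚ → x ≤1/ k ^ η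
≤1/^-from-ℕ {x} {k} {e = e} η≤e 0≤x xk^e≤1 p q p/q<η = begin
  x ^ℚ q * ⟦ k ⟧ ^ℚ p                ≤⟨ *-monoˡ-≤ (x ^ℚ q) (^-nonNeg q 0≤x) (^-monoʳ-≤ (⟦⟧-mono-≤ (ℕ.>-nonZero⁻¹ k)) (η≤e p q p/q<η)) ⟩
  x ^ℚ q * ⟦ k ⟧ ^ℚ (e ℕ.* q)        ≡⟨ cong (x ^ℚ q *_) (^-assocʳ ⟦ k ⟧ e q) ⟨
  x ^ℚ q * (⟦ k ⟧ ^ℚ e) ^ℚ q         ≡⟨ ^-distrib-* x (⟦ k ⟧ ^ℚ e) q ⟨
  (x * ⟦ k ⟧ ^ℚ e) ^ℚ q              ≤⟨ ^≤1 q (*-nonNeg 0≤x (^-nonNeg e 0≤⟦ k ⟧)) xk^e≤1 ⟩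
  1ℚ                                 ∎
  where open ≤-Reasoning

-- Choice of the parameters

reciprocal : ∀ x → 1ℚ ≤ x → ∃[ y ] 0ℚ ≤ y × y * x ≡ 1ℚ
reciprocal x 1≤x = y , nonNegative⁻¹ y {{pos⇒nonNeg y {{1/pos⇒pos x {{0<x}}}}}} , *-inverseˡ x {{pos⇒nonZero x {{0<x}}}}
  where
  0<x : ℚ.Positive x
  0<x = positive (<-≤-trans (positive⁻¹ 1ℚ) 1≤x)
  y : ℚ
  y = (1/ x) {{pos⇒nonZero x {{0<x}}}}

-- Of the `1 + 16 (e + 1)` factors `b` per station, one cancels its initial weight `B`; the others
-- cancel the power of `K`, by the bound on `K`.
overload-cost : ∀ {b B K} k e → 0ℚ ≤ b → 0ℚ ≤ K → b * B ≡ 1ℚ → K ≤ B ^ℚ (16 ℕ.* k) →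
                (b ^ℚ suc (16 ℕ.* suc e)) ^ℚ k * B ^ℚ k * K ^ℚ suc e ≤ 1ℚ
overload-cost {b} {B} {K} k e 0≤b 0≤K bB≡1 K≤B^16k = begin
  (b * b ^ℚ s) ^ℚ k * B ^ℚ k * K ^ℚ suc e          ≡⟨ cong (_* K ^ℚ suc e) (^-distrib-* (b * b ^ℚ s) B k) ⟨
  (b * b ^ℚ s * B) ^ℚ k * K ^ℚ suc e               ≡⟨ cong (λ x → x ^ℚ k * K ^ℚ suc e) (trans (eq₁ b (b ^ℚ s) B) (trans (cong (b ^ℚ s *_) bB≡1) (*-identityʳ (b ^ℚ s)))) ⟩
  (b ^ℚ s) ^ℚ k * K ^ℚ suc e                       ≡⟨ cong (_* K ^ℚ suc e) (trans (^-assocʳ b s k) (trans (cong (b ^ℚ_) (eq₂ k e)) (sym (^-assocʳ b (16 ℕ.* k) (suc e))))) ⟩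
  (b ^ℚ (16 ℕ.* k)) ^ℚ suc e * K ^ℚ suc e          ≡⟨ ^-distrib-* (b ^ℚ (16 ℕ.* k)) K (suc e) ⟨
  (b ^ℚ (16 ℕ.* k) * K) ^ℚ suc e                   ≤⟨ ^≤1 (suc e) (*-nonNeg (^-nonNeg (16 ℕ.* k) 0≤b) 0≤K) b^K≤1 ⟩
  1ℚ                                               ∎
  where
  open ≤-Reasoning
  s = 16 ℕ.* suc e
  eq₁ : ∀ b x B → b * x * B ≡ x * (b * B)
  eq₁ = solve-∀ ring
  eq₂ : ∀ k e → 16 ℕ.* (1 ℕ.+ e) ℕ.* k ≡ 16 ℕ.* k ℕ.* (1 ℕ.+ e)
  eq₂ = solveℕ-∀
  b^K≤1 : b ^ℚ (16 ℕ.* k) * K ≤ 1ℚ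
  b^K≤1 = ≤-trans (*-monoˡ-≤ (b ^ℚ (16 ℕ.* k)) (^-nonNeg (16 ℕ.* k) 0≤b) K≤B^16k) (≤-reflexive (inverse^ (16 ℕ.* k) bB≡1))

-- `x` is the initial total weight for `ψ₂`, which the factor `½` cancels.
late-cost : ∀ {κ K x} n → 0ℚ ≤ κ → 0ℚ ≤ K → κ * K ≡ 1ℚ → x ≤ ⟦ 2 ⟧ → ½ * κ ^ℚ n * x * K ^ℚ n ≤ 1ℚ
late-cost {κ} {K} {x} n 0≤κ 0≤K κK≡1 x≤2 = begin
  ½ * κ ^ℚ n * x * K ^ℚ n          ≤⟨ *-monoʳ-≤ (K ^ℚ n) (^-nonNeg n 0≤K) (*-monoˡ-≤ (½ * κ ^ℚ n) (*-nonNeg (from-yes (0ℚ ≤? ½)) (^-nonNeg n 0≤κ)) x≤2) ⟩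
  ½ * κ ^ℚ n * ⟦ 2 ⟧ * K ^ℚ n      ≡⟨ eq (κ ^ℚ n) (K ^ℚ n) ⟩
  κ ^ℚ n * K ^ℚ n                  ≡⟨ inverse^ n κK≡1 ⟩
  1ℚ                               ∎
  where
  open ≤-Reasoning
  eq : ∀ x y → ½ * x * ⟦ 2 ⟧ * y ≡ x * y
  eq = solve-∀ ring

-- Of the three additional factors `K` in the growth, one makes up for `ψ = 1 / 2K`. The other two,
-- each at least 2, make up for `½` twice: once from `ψ` and once from the coefficient.
1≤late-weight : ∀ {κ K ψ g} n → 0ℚ ≤ κ → 0ℚ ≤ ψ → κ * K ≡ 1ℚ → ⟦ 2 ⟧ ≤ K → ψ * (⟦ 2 ⟧ * K) ≡ 1ℚ →
                K ^ℚ (n ℕ.+ 3) ≤ g → 1ℚ ≤ ½ * κ ^ℚ n * (1ℚ + ψ * g)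
1≤late-weight {κ} {K} {ψ} {g} n 0≤κ 0≤ψ κK≡1 2≤K 2Kψ≡1 K^≤g = begin
  1ℚ                                              ≡⟨⟩
  ¼ * (⟦ 2 ⟧ * ⟦ 2 ⟧)                             ≤⟨ *-monoˡ-≤ ¼ 0≤¼ (*-mono-≤ 0≤⟦ 2 ⟧ 0≤⟦ 2 ⟧ 2≤K 2≤K) ⟩
  ¼ * (K * K)                                     ≡⟨ *-identityʳ (¼ * (K * K)) ⟨
  ¼ * (K * K) * (1ℚ * 1ℚ)                         ≡⟨ cong₂ (λ x y → ¼ * (K * K) * (x * y)) (inverse^ n κK≡1) 2Kψ≡1 ⟨
  ¼ * (K * K) * (κ ^ℚ n * K ^ℚ n * (ψ * (⟦ 2 ⟧ * K))) ≡⟨ eq (κ ^ℚ n) (K ^ℚ n) ψ K ⟩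
  ½ * κ ^ℚ n * (ψ * (K ^ℚ n * K ^ℚ 3))            ≡⟨ cong (λ x → ½ * κ ^ℚ n * (ψ * x)) (^-homo-* K n 3) ⟨
  ½ * κ ^ℚ n * (ψ * K ^ℚ (n ℕ.+ 3))               ≤⟨ *-monoˡ-≤ β 0≤β (*-monoˡ-≤ ψ 0≤ψ K^≤g) ⟩
  ½ * κ ^ℚ n * (ψ * g)                            ≤⟨ *-monoˡ-≤ β 0≤β (≤-by 1ℚ 0≤1 (+-comm 1ℚ (ψ * g))) ⟩
  ½ * κ ^ℚ n * (1ℚ + ψ * g)                       ∎
  where
  open ≤-Reasoning
  β = ½ * κ ^ℚ n
  0≤β : 0ℚ ≤ β
  0≤β = *-nonNeg (from-yes (0ℚ ≤? ½)) (^-nonNeg n 0≤κ)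
  eq : ∀ x y ψ K → ¼ * (K * K) * (x * y * (ψ * (⟦ 2 ⟧ * K))) ≡ ½ * x * (ψ * (y * (K * (K * (K * 1ℚ)))))
  eq = solve-∀ ring

-- The protocol with fixed parameters

module Execution (k : ℕ) .{{_ : NonZero k}} (2≤k : 2 ℕ.≤ k) (c e : ℕ)
  (8M≤c : 8 ℕ.* (4 ℕ.* 3 ℕ.^ (suc (16 ℕ.* suc e) ℕ.* 2)) ℕ.≤ c) (16[e+4]≤c : 16 ℕ.* (suc e ℕ.+ 3) ℕ.≤ c)
  where

  -- m is chosen by (1 + ψ₁)^16k ≥ k in overload-cost, and M for the sake of phase-weight.
  L D m M d : ℕ
  L = loglog k
  D = 2 ℕ.^ L
  m = suc (16 ℕ.* suc e)
  M = 4 ℕ.* 3 ℕ.^ (m ℕ.* 2)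
  d = 5 ℕ.* c ℕ.* k

  ps : List ℚ
  ps = NonAdaptiveWithK k c

  length-ps≤d : length ps ℕ.≤ d
  length-ps≤d = length-NonAdaptiveWithK k c (loglog≤2k 2≤k)

  prob-cases : ∀ a → prob ps a ≡ 0ℚ ⊎
    (∃[ l ] l ℕ.≤ L × prob ps a ≡ phaseProb k l × ⟦ M ⟧ ^ℚ l ≤ growth ps a)
  prob-cases a = [ (λ len≤a → inj₁ (prob-≥length ps len≤a)) , (λ a<len → inj₂ (in-phase a<len)) ]′
    (ℕ.≤-<-connex (length ps) a)
    where
    in-phase : a ℕ.< length ps → ∃[ l ] l ℕ.≤ L × prob ps a ≡ phaseProb k l × ⟦ M ⟧ ^ℚ l ≤ growth ps a
    in-phase a<len = let l , l<1+L , p≡ , M^l≤ = prob-phases k c {M} 8M≤c (suc L) ℕ.≤-refl a a<len in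
      l , ℕ.≤-pred l<1+L , p≡ , M^l≤

  0≤p : ∀ a → 0ℚ ≤ prob ps a
  0≤p a = [ (λ p≡0 → ≤-reflexive (sym p≡0))
          , (λ (l , _ , p≡ , _) → ≤-trans (0≤phaseProb k c l) (≤-reflexive (sym p≡))) ]′ (prob-cases a)

  phaseProb≤1 : ∀ l → l ℕ.≤ L → phaseProb k l ≤ 1ℚ
  phaseProb≤1 l l≤L = *⟦⟧-cancel-≤ (2 ℕ.* k) {{ℕ.m*n≢0 2 k}} (begin
    phaseProb k l * ⟦ 2 ℕ.* k ⟧  ≡⟨ phaseProb*2k k c l ⟩
    ⟦ 2 ℕ.^ l ⟧                  ≤⟨ ⟦⟧-mono-≤ (ℕ.≤-trans (ℕ.^-monoʳ-≤ 2 l≤L) (2^loglog≤2k 2≤k)) ⟩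
    ⟦ 2 ℕ.* k ⟧                  ≡⟨ *-identityˡ ⟦ 2 ℕ.* k ⟧ ⟨
    1ℚ * ⟦ 2 ℕ.* k ⟧             ∎)
    where open ≤-Reasoning

  p≤1 : ∀ a → prob ps a ≤ 1ℚ
  p≤1 a = [ (λ p≡0 → ≤-trans (≤-reflexive p≡0) 0≤1)
          , (λ (l , l≤L , p≡ , _) → ≤-trans (≤-reflexive p≡) (phaseProb≤1 l l≤L)) ]′ (prob-cases a)

  p≡0 : ∀ a → d ℕ.≤ a → prob ps a ≡ 0ℚ
  p≡0 a d≤a = prob-≥length ps (ℕ.≤-trans length-ps≤d d≤a)

  open Potential ps d 0≤p p≤1 p≡0

  -- The last phase has `c ℕ.* k` rounds, and every `16 ℕ.* k` of them gain a factor of at least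
  -- `k`.
  last-phase : ⟦ k ⟧ ^ℚ (suc e ℕ.+ 3) ≤ (1ℚ + ¼ * phaseProb k L) ^ℚ (c ℕ.* φ k L)
  last-phase = begin
    ⟦ k ⟧ ^ℚ f                        ≤⟨ ^-monoˡ-≤ f 0≤⟦ k ⟧ (k≤[1+y]^16k 2≤k (*-nonNeg 0≤¼ (0≤phaseProb k c L)) (¼phaseProb*8k k c L)) ⟩
    (x ^ℚ (16 ℕ.* k)) ^ℚ f            ≡⟨ ^-assocʳ x (16 ℕ.* k) f ⟩
    x ^ℚ (16 ℕ.* k ℕ.* f)             ≤⟨ ^-monoʳ-≤ (1≤1+¼phaseProb k c L) 16kf≤ ⟩
    x ^ℚ (c ℕ.* φ k L)                ∎
    where
    open ≤-Reasoning
    f = suc e ℕ.+ 3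
    x = 1ℚ + ¼ * phaseProb k L
    eq : ∀ k f → 16 ℕ.* k ℕ.* f ≡ 16 ℕ.* f ℕ.* k
    eq = solveℕ-∀
    16kf≤ : 16 ℕ.* k ℕ.* f ℕ.≤ c ℕ.* φ k L
    16kf≤ = ℕ.≤-trans (ℕ.≤-reflexive (eq k f)) (ℕ.≤-trans (ℕ.*-monoˡ-≤ k 16[e+4]≤c)
              (ℕ.≤-reflexive (cong (c ℕ.*_) (sym (φ-last k c)))))

  1≤M : 1ℚ ≤ ⟦ M ⟧
  1≤M = ⟦⟧-mono-≤ (ℕ.>-nonZero⁻¹ M {{ℕ.m*n≢0 4 _ {{_}} {{ℕ.m^n≢0 3 (m ℕ.* 2)}}}})

  k^≤growth : ⟦ k ⟧ ^ℚ (suc e ℕ.+ 3) ≤ growth ps d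
  k^≤growth = begin
    ⟦ k ⟧ ^ℚ (suc e ℕ.+ 3)                   ≡⟨ *-identityˡ _ ⟨
    1ℚ * ⟦ k ⟧ ^ℚ (suc e ℕ.+ 3)              ≤⟨ *-mono-≤ 0≤1 (^-nonNeg (suc e ℕ.+ 3) 0≤⟦ k ⟧)
                                                  (≤-trans (1≤^ L 1≤M) (M^n≤growth-phases k c {M} 8M≤c L ℕ.≤-refl)) last-phase ⟩
    _                                        ≡⟨ growth-phases-suc k c L ⟨
    growth ps (length ps)                    ≤⟨ growth-mono-≤ length-ps≤d ⟩
    growth ps d                              ∎
    where open ≤-Reasoning

  -- `ψ₁` is small enough for the linear expansion in `phase-weight` in every phase, and yet of
  -- order 1 / log k, so that `(1ℚ + ψ₁) ^ℚ (16 ℕ.* k)` reaches `k`. `ψ₂` keeps the initial total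
  -- weight of `k` stations at most 2.
  ψ₁ ψ₂ : ℚ
  ψ₁ = (+ 1 / (2 ℕ.* D)) {{ℕ.m*n≢0 2 D {{_}} {{ℕ.m^n≢0 2 L}}}}
  ψ₂ = (+ 1 / (2 ℕ.* k)) {{ℕ.m*n≢0 2 k}}

  0≤ψ₁ : 0ℚ ≤ ψ₁
  0≤ψ₁ = 0≤/ 1 (2 ℕ.* D) {{ℕ.m*n≢0 2 D {{_}} {{ℕ.m^n≢0 2 L}}}}

  0≤ψ₂ : 0ℚ ≤ ψ₂
  0≤ψ₂ = 0≤/ 1 (2 ℕ.* k) {{ℕ.m*n≢0 2 k}}

  2Dψ₁≡1 : ψ₁ * ⟦ 2 ℕ.* D ⟧ ≡ 1ℚ
  2Dψ₁≡1 = /-*-cancel 1 (2 ℕ.* D) {{ℕ.m*n≢0 2 D {{_}} {{ℕ.m^n≢0 2 L}}}}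

  2kψ₂≡1 : ψ₂ * ⟦ 2 ℕ.* k ⟧ ≡ 1ℚ
  2kψ₂≡1 = /-*-cancel 1 (2 ℕ.* k) {{ℕ.m*n≢0 2 k}}

  B R : ℚ
  B = 1ℚ + ψ₁
  R = B ^ℚ m

  1≤B : 1ℚ ≤ B
  1≤B = ≤-by ψ₁ 0≤ψ₁ refl

  1≤R² : 1ℚ ≤ R ^ℚ 2
  1≤R² = 1≤^ 2 (1≤^ m 1≤B)

  -- Phase 0 lives on the spare factor `R ^ℚ 2` alone; in later phases the growth suffices without
  -- it.
  phase-load : ∀ l {g} → l ℕ.≤ L → ⟦ M ⟧ ^ℚ l ≤ g → (R ^ℚ 2) ^ℚ (2 ℕ.^ l) ≤ (1ℚ + ψ₁ * g) * R ^ℚ 2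
  phase-load zero {g} _ 1≤g = subst (_≤ (1ℚ + ψ₁ * g) * R ^ℚ 2) (*-comm 1ℚ (R ^ℚ 2))
    (*-monoʳ-≤ {1ℚ} {1ℚ + ψ₁ * g} (R ^ℚ 2) (≤-trans 0≤1 1≤R²) (≤-by (ψ₁ * g) (*-nonNeg 0≤ψ₁ (≤-trans 0≤1 1≤g)) refl))
  phase-load (suc l) {g} l<L M^l≤g = begin
    (R ^ℚ 2) ^ℚ (2 ℕ.^ suc l)               ≡⟨ cong (_^ℚ (2 ℕ.^ suc l)) (^-assocʳ B m 2) ⟩
    (B ^ℚ (m ℕ.* 2)) ^ℚ (2 ℕ.^ suc l)       ≤⟨ phase-weight {D} (m ℕ.* 2) l 0≤ψ₁ 2Dψ₁≡1 (ℕ.^-monoʳ-≤ 2 l<L) ⟩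
    1ℚ + ψ₁ * ⟦ M ⟧ ^ℚ suc l                ≤⟨ +-monoʳ-≤ 1ℚ (*-monoˡ-≤ ψ₁ 0≤ψ₁ M^l≤g) ⟩
    1ℚ + ψ₁ * g                             ≡⟨ *-identityʳ (1ℚ + ψ₁ * g) ⟨
    (1ℚ + ψ₁ * g) * 1ℚ                      ≤⟨ *-monoˡ-≤ (1ℚ + ψ₁ * g) (+-nonNeg 0≤1 (*-nonNeg 0≤ψ₁ 0≤g)) 1≤R² ⟩
    (1ℚ + ψ₁ * g) * R ^ℚ 2                  ∎
    where
    open ≤-Reasoning
    0≤g = ≤-trans (^-nonNeg (suc l) 0≤⟦ M ⟧) M^l≤g

  Load : Status → Set
  Load s = ∃[ u ] txProb ps s * ⟦ 2 ℕ.* k ⟧ ≡ ⟦ u ⟧ × (R ^ℚ 2) ^ℚ u ≤ weight 0≤ψ₁ s * R ^ℚ 2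

  silent-load : ∀ s → txProb ps s ≡ 0ℚ → Load s
  silent-load s p≡0 = 0 , trans (cong (_* ⟦ 2 ℕ.* k ⟧) p≡0) (*-zeroˡ ⟦ 2 ℕ.* k ⟧) , 1≤* (1≤weight 0≤ψ₁ s) 1≤R²

  load : ∀ s → Load s
  load asleep        = silent-load asleep refl
  load (delivered a) = silent-load (delivered a) refl
  load (active a)    = [ silent-load (active a) , in-phase ]′ (prob-cases a)
    where
    in-phase : (∃[ l ] l ℕ.≤ L × prob ps a ≡ phaseProb k l × ⟦ M ⟧ ^ℚ l ≤ growth ps a) → Load (active a)
    in-phase (l , l≤L , p≡ , M^l≤) =
      2 ℕ.^ l , trans (cong (_* ⟦ 2 ℕ.* k ⟧) p≡) (phaseProb*2k k c l) , phase-load l l≤L M^l≤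

  module _ {b : ℚ} (0≤b : 0ℚ ≤ b) (bB≡1 : b * B ≡ 1ℚ) (A : Adversary k) (T : ℕ) where

    α κ β : ℚ
    α = (b ^ℚ m) ^ℚ k
    κ = + 1 / k
    β = ½ * κ ^ℚ suc e

    κk≡1 : κ * ⟦ k ⟧ ≡ 1ℚ
    κk≡1 = /-*-cancel 1 k

    2≤⟦k⟧ : ⟦ 2 ⟧ ≤ ⟦ k ⟧
    2≤⟦k⟧ = ⟦⟧-mono-≤ 2≤k

    0≤α : 0ℚ ≤ α
    0≤α = ^-nonNeg k (^-nonNeg m 0≤b)

    0≤κ : 0ℚ ≤ κ
    0≤κ = 0≤/ 1 k

    0≤β : 0ℚ ≤ β
    0≤β = *-nonNeg (from-yes (0ℚ ≤? ½)) (^-nonNeg (suc e) 0≤κ)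

    overloaded : ∀ (h : History k) → ¬ (∑ (λ i → txProb ps (status h i)) ≤ 1ℚ - ¼) → 1ℚ ≤ α * totalWeight 0≤ψ₁ h
    overloaded h = overload {u = λ i → proj₁ (load (status h i))} (^-nonNeg m 0≤b) (1≤^ m 1≤B) (inverse^ {b} {B} m bB≡1)
      (λ i → proj₁ (proj₂ (load (status h i)))) (λ i → proj₂ (proj₂ (load (status h i))))

    late : 1ℚ ≤ β * (1ℚ + ψ₂ * growth ps d)
    late = 1≤late-weight (suc e) 0≤κ 0≤ψ₂ κk≡1 2≤⟦k⟧ (trans (cong (ψ₂ *_) (sym (⟦⟧-* 2 k))) 2kψ₂≡1) k^≤growth

    failure : ℚ
    failure = 1ℚ - Pr ps A T (allOnTime? d)

    0≤failure : 0ℚ ≤ failure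
    0≤failure = p≤q⇒0≤q-p (𝔼-run≤1 A 0≤ψ₁ 0≤ψ₂ 0≤α 0≤β overloaded late T [])

    totalWeight-[] : ∀ {ψ} (0≤ψ : 0ℚ ≤ ψ) → totalWeight 0≤ψ {k} [] ≡ (1ℚ + ψ) ^ℚ k
    totalWeight-[] {ψ} 0≤ψ = trans (∏-replicate k (1ℚ + ψ * 1ℚ)) (cong (λ x → (1ℚ + x) ^ℚ k) (*-identityʳ ψ))

    [1+ψ₂]^k≤2 : (1ℚ + ψ₂) ^ℚ k ≤ ⟦ 2 ⟧
    [1+ψ₂]^k≤2 = subst (λ x → (1ℚ + ψ₂) ^ℚ k ≤ 1ℚ + x) 2kψ₂≡1′ ([1+x]^n≤1+2nx k 0≤ψ₂ (≤-reflexive 2kψ₂≡1′))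
      where
      2kψ₂≡1′ : ⟦ 2 ⟧ * ⟦ k ⟧ * ψ₂ ≡ 1ℚ
      2kψ₂≡1′ = trans (*-comm _ ψ₂) (trans (cong (ψ₂ *_) (sym (⟦⟧-* 2 k))) 2kψ₂≡1)

    -- Overload and lateness each contribute at most 1 after multiplication by `k` to the power
    -- `suc e`; as `2 ≤ k`, the additional factor `k` absorbs their sum.
    failure*k^e≤1 : failure * ⟦ k ⟧ ^ℚ e ≤ 1ℚ
    failure*k^e≤1 = *⟦⟧-cancel-≤ k (begin
      failure * ⟦ k ⟧ ^ℚ e * ⟦ k ⟧                       ≡⟨ eq₁ failure ⟦ k ⟧ (⟦ k ⟧ ^ℚ e) ⟩
      failure * ⟦ k ⟧ ^ℚ suc e                           ≤⟨ *-monoʳ-≤ (⟦ k ⟧ ^ℚ suc e) (^-nonNeg (suc e) 0≤⟦ k ⟧)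
                                                              (1-𝔼-run≤risk A 0≤ψ₁ 0≤ψ₂ 0≤α 0≤β overloaded late T []) ⟩
      (α * totalWeight 0≤ψ₁ {k} [] + β * totalWeight 0≤ψ₂ {k} []) * ⟦ k ⟧ ^ℚ suc e
        ≡⟨ cong₂ (λ x y → (α * x + β * y) * ⟦ k ⟧ ^ℚ suc e) (totalWeight-[] 0≤ψ₁) (totalWeight-[] 0≤ψ₂) ⟩
      (α * B ^ℚ k + β * (1ℚ + ψ₂) ^ℚ k) * ⟦ k ⟧ ^ℚ suc e  ≡⟨ *-distribʳ-+ (⟦ k ⟧ ^ℚ suc e) (α * B ^ℚ k) (β * (1ℚ + ψ₂) ^ℚ k) ⟩
      α * B ^ℚ k * ⟦ k ⟧ ^ℚ suc e + β * (1ℚ + ψ₂) ^ℚ k * ⟦ k ⟧ ^ℚ suc e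
        ≤⟨ +-mono-≤ (overload-cost k e 0≤b 0≤⟦ k ⟧ bB≡1 (k≤[1+ψ]^16k 2≤k 0≤ψ₁ 2Dψ₁≡1))
                    (late-cost (suc e) 0≤κ 0≤⟦ k ⟧ κk≡1 [1+ψ₂]^k≤2) ⟩
      ⟦ 2 ⟧                                              ≤⟨ 2≤⟦k⟧ ⟩
      ⟦ k ⟧                                              ≡⟨ *-identityˡ ⟦ k ⟧ ⟨
      1ℚ * ⟦ k ⟧                                         ∎)
      where
      open ≤-Reasoning
      eq₁ : ∀ x K y → x * y * K ≡ x * (K * y)
      eq₁ = solve-∀ ring

-- The first summand lets every early phase multiply the growth by `M`; the second lets the last
-- phase multiply it by `k` to the power `e + 4`.
threshold : ℕ → ℕ
threshold e = 8 ℕ.* (4 ℕ.* 3 ℕ.^ (suc (16 ℕ.* suc e) ℕ.* 2)) ℕ.+ 16 ℕ.* (suc e ℕ.+ 3)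

succeedWithinWhp : ∀ {e} {η : ℝ} → (∀ p q .{{_ : NonZero q}} → lower η (+ p / q) → p ℕ.≤ e ℕ.* q) →
  ∀ c → threshold e ℕ.≤ c → ∀ k .{{_ : NonZero k}} → 2 ℕ.≤ k → (A : Adversary k) →
  SucceedWithinWhp (5 ℕ.* c ℕ.* k) η (NonAdaptiveWithK k c) A
succeedWithinWhp {e} {η} η≤e c e≤c k 2≤k A T = ≤1/^-from-ℕ {η = η} {e} η≤e (0≤failure 0≤b bB≡1 A T) (failure*k^e≤1 0≤b bB≡1 A T)
  where
  open Execution k 2≤k c e (ℕ.m+n≤o⇒m≤o _ e≤c) (ℕ.m+n≤o⇒n≤o _ e≤c)
  0≤b  = proj₁ (proj₂ (reciprocal B 1≤B))
  bB≡1 = proj₂ (proj₂ (reciprocal B 1≤B))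

theorem3p1 : Σ (ℕ → ℕ) λ C →
    ∀ (η : ℝ) → Positive η →
    ∃ λ (c₀ : ℕ) → ∀ (c : ℕ) → c₀ ℕ.≤ c →
    ∀ (k : ℕ) .{{_ : NonZero k}} → 2 ℕ.≤ k →
    ∀ (A : Adversary k) → ActivatesAll (NonAdaptiveWithK k c) A →
    SucceedWithinWhp (C c ℕ.* k) η (NonAdaptiveWithK k c) A
-- `5 ℕ.* c ℕ.* k` rounds cover the whole schedule, so a late station has gone through all phases
-- without success.
theorem3p1 = (λ c → 5 ℕ.* c) , λ η _ → let e , η≤e = upper-bound η in
  threshold e , λ c e≤c k 2≤k A _ → succeedWithinWhp {e} {η} η≤e c e≤c k 2≤k A
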